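{- Let $p$ be an odd prime, let $\alpha$ be a primitive element of $\mathbb{F}_p$, let $\mathbf{s}$ be the SLCE sequence over $\mathbb{F}_p^*$ defined using $\alpha$, and let $S\subset \mathbb{Z}/(p-1)\mathbb{Z}$ be the corresponding SLCE almost difference set. Then the multiplier group of $S$ is trivial (i.e. equal to $\{1\}$), and $\mathcal{F}_1 = \{ \mathbf{s}[t'] : t \in (\mathbb{Z}/(p-1)\mathbb{Z})^* \}$ is a family of $\phi(p-1)$ pairwise shift-inequivalent decimations of $\mathbf{s}$.
   Context: SLCE sequence: let $q$ be a power of an odd prime and $\alpha$ a primitive element of $\mathbb{F}_q$. The Sidelnikov-Lempel-Cohn-Eastman (SLCE) sequence $\mathbf{s}=s_0s_1s_2\ldots$ over $\mathbb{F}_q^*$ defined using $\alpha$ is the binary sequence, periodic with $s_{j+q-1}=s_j$, given for $0\le j<q-1$ by $s_j=0$ if $\alpha^j+1$ is $0$ or a nonzero square in $\mathbb{F}_q$, and $s_j=1$ if $\alpha^j+1$ is a nonsquare in $\mathbb{F}_q$. The corresponding SLCE almost difference set is $S=\{j\in\mathbb{Z}/(q-1)\mathbb{Z} : s_j=1\}$ (equivalently, via $j\mapsto\alpha^j$, a subset of the cyclic group $\mathbb{F}_q^*$). Here $q=p$. Multipliers: a residue $t\in(\mathbb{Z}/(q-1)\mathbb{Z})^*$ is a multiplier of $S$ if there is $c\in\mathbb{Z}/(q-1)\mathbb{Z}$ with $\{tj : j\in S\}=\{j+c : j\in S\}$. The multipliers of $S$ form a subgroup of $(\mathbb{Z}/(q-1)\mathbb{Z})^*$,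 the multiplier group. For a residue class $r\in\mathbb{Z}/n\mathbb{Z}$, $r'$ denotes the least positive integer in the class $r$. For an integer $t\ge1$, the decimation $\mathbf{a}[t]$ of a sequence $\mathbf{a}$ is the sequence whose $i$th entry is $a_{ti}$. Two periodic sequences $\mathbf{a},\mathbf{b}$ of the same period are shift-equivalent if there is an integer $\ell$ such that $a_i=b_{i+\ell}$ for all $i$ (indices read modulo the period), and shift-inequivalent otherwise. $\phi$ is the Euler totient function.
   Formalization: The prime p = 5 is excluded, because the claim fails there: for α = 2 one has S = {0,1} and 3S = {0,3} = S + 3, so 3 is a nontrivial multiplier (α = 3 fails likewise). -}

module Defs where

open import Algebra.Bundles using (RawSemiring)
import Algebra.Definitions.RawSemiring as RawSemiringDefs
open import Data.Bool.Base using (if_then_else_)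
open import Data.Digit using (Bit; 0b; 1b)
open import Data.Fin.Base using (Fin; zero; suc; toℕ)
open import Data.Fin.Patterns using (0F; 1F; 2F; 3F)
open import Data.Fin.Properties using (any?; _≟_)
open import Data.Integer.Base as ℤ using (+_; _%ℕ_)
open import Data.List.Base using (length; filter; map; upTo)
open import Data.Nat.Base as ℕ using (ℕ; suc; _∸_; _%_; NonZero; NonTrivial; nonTrivial⇒nonZero)
open import Data.Nat.Coprimality using (coprime?)
open import Data.Nat.DivMod using (_mod_)
open import Data.Product.Base using (Σ; ∃; ∃-syntax; _×_; _,_; proj₁)
open import Level using (0ℓ)
open import Relation.Binary.Bundles using (Setoid)
import Relation.Binary.Construct.On as On
open import Relation.Binary.PropositionalEquality using (_≡_; _≢_; _≗_; _→-setoid_; refl)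
open import Relation.Nullary.Decidable using (Dec; does)
open import Relation.Unary using (Pred; _≐_)

-- The ring ℤ/nℤ on canonical representatives; for prime n it is the field
-- with n elements.
ℤ/ : (n : ℕ) → .{{NonZero n}} → RawSemiring 0ℓ 0ℓ
ℤ/ n = record
  { Carrier = Fin n
  ; _≈_     = _≡_
  ; _+_     = λ x y → (toℕ x ℕ.+ toℕ y) mod n
  ; _*_     = λ x y → (toℕ x ℕ.* toℕ y) mod n
  ; 0#      = 0 mod n
  ; 1#      = 1 mod n
  }

φ : ℕ → ℕ
φ n = length (filter (λ k → coprime? k n) (map suc (upTo n)))

image : {A B : Set} → (A → B) → Pred A 0ℓ → Pred B 0ℓ
image f P y = ∃[ x ] (P x × y ≡ f x)

Sequence : Set
Sequence = ℕ → Bit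

_[_] : Sequence → ℕ → Sequence
(a [ t ]) i = a (t ℕ.* i)

module Residues (n : ℕ) .{{_ : NonZero n}} where

  open RawSemiring (ℤ/ n) public using (_+_; _*_; 0#; 1#)
  open RawSemiringDefs (ℤ/ n) public using (_^_)

  IsUnit : Pred (Fin n) 0ℓ
  IsUnit t = ∃[ u ] (t * u ≡ 1#)

  leastPositive : Fin n → ℕ
  leastPositive zero      = n
  leastPositive r@(suc _) = toℕ r

  MultiplierGroup : Pred (Fin n) 0ℓ → Pred (Fin n) 0ℓ
  MultiplierGroup S t = IsUnit t × ∃[ c ] (image (t *_) S ≐ image (_+ c) S)

  -- For sequences of period n; the shift ℓ may be negative, so the index is
  -- reduced modulo n.
  ShiftEquivalent : Sequence → Sequence → Set
  ShiftEquivalent a b = ∃[ ℓ ] (∀ i → a i ≡ b ((+ i ℤ.+ ℓ) %ℕ n))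

  UnitDecimations : Sequence → Pred Sequence 0ℓ
  UnitDecimations s a = ∃[ t ] (IsUnit t × a ≗ s [ leastPositive t ])

-- Members of a set of sequences, where sequences are equal when all of their
-- entries are; the membership witness is ignored.
memberSetoid : Pred Sequence 0ℓ → Setoid 0ℓ 0ℓ
memberSetoid F = On.setoid {B = Σ Sequence F} (ℕ →-setoid Bit) proj₁

module SLCE (p : ℕ) .{{_ : NonTrivial p}} where

  private instance
    p≢0 : NonZero p
    p≢0 = nonTrivial⇒nonZero p

    p∸1≢0 : NonZero (p ∸ 1)
    p∸1≢0 = pred≢0 p
      where
      pred≢0 : ∀ n → .{{NonTrivial n}} → NonZero (n ∸ 1)
      pred≢0 (suc (suc _)) = _

  module 𝔽 = Residues p {{p≢0}}
  module Exp = Residues (p ∸ 1) {{p∸1≢0}}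

  IsPrimitive : Pred (Fin p) 0ℓ
  IsPrimitive α = α ≢ 𝔽.0# × (∀ x → x ≢ 𝔽.0# → ∃[ j ] (α 𝔽.^ j ≡ x))

  IsSquare : Pred (Fin p) 0ℓ
  IsSquare x = ∃[ y ] (y 𝔽.* y ≡ x)

  isSquare? : ∀ x → Dec (IsSquare x)
  isSquare? x = any? (λ y → y 𝔽.* y ≟ x)

  -- 0 = 0 * 0 is a square here, so the bit is 0 at 0 and at nonzero squares.
  slce : Fin p → Sequence
  slce α j = if does (isSquare? ((α 𝔽.^ (j % (p ∸ 1))) 𝔽.+ 𝔽.1#)) then 0b else 1b

  slceSet : Fin p → Pred (Fin (p ∸ 1)) 0ℓ
  slceSet α j = slce α (toℕ j) ≡ 1b

-- For p = 5 and α = 2 the sequence is 1100 1100 …, so S = {0, 1} and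
-- 3 S = {0, 3} = S + 3: the multiplier group is not trivial. This is why p = 5
-- has to be excluded from the theorem.
3-multiplier-at-5 : let open SLCE 5 in Exp.MultiplierGroup (slceSet 2F) 3F
3-multiplier-at-5 = (3F , refl) , 3F , to , from
  where
  open SLCE 5
  to : ∀ {y} → image (3F Exp.*_) (slceSet 2F) y → image (Exp._+ 3F) (slceSet 2F) y
  to (0F , _ , refl) = 1F , refl , refl
  to (1F , _ , refl) = 0F , refl , refl
  to (2F , () , _)
  to (3F , () , _)
  from : ∀ {y} → image (Exp._+ 3F) (slceSet 2F) y → image (3F Exp.*_) (slceSet 2F) y
  from (0F , _ , refl) = 1F , refl , refl
  from (1F , _ , refl) = 0F , refl , refl
  from (2F , () , _)
  from (3F , () , _)

-- Let n = p - 1 = 2 m, and let χ (i) = ± 1 be the sign of the bit s_i. Euler's criterion and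
-- the binomial theorem give χ (i) = ∑_{j < n} h_j α^(i j) with h_j = C(m , j) - (-1)^j; the
-- second term accounts for the zero of (1 + x)^m at x = - 1. If s_{t i} = s_{i + d} for all i
-- and γ = α^d, comparing Fourier coefficients yields h_j γ^j = h_l whenever j ≡ t l (mod n).
-- For m < j < n one has h_j = - (-1)^j, so, applying this to the pair (- l , - j), γ^j = 1 as
-- soon as l and j both lie strictly between 0 and m.
--
-- Put δ = γ^t. If γ ≠ 1, then l = 1 gives δ = h_1 = 1/2, and l = 2 gives δ² = 1 or - δ² = h_2
-- = - 5/8. Both force 3 = 0 in 𝔽_p, which is impossible for m > 2; m = 2 is p = 5, and for
-- m = 1 the only unit is 1. If γ = 1, then C(m , j) = C(m , l) whenever j ≡ t l, so
-- multiplication by t permutes {0 , … , m} modulo 2 m, hence t = 1.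
{-# OPTIONS --safe #-}
module Submission where

open import Defs
open import Algebra.Bundles using (CommutativeRing)
import Algebra.Properties.CommutativeSemiring.Exp as Power
import Algebra.Properties.Ring as RingProperties
import Algebra.Properties.Semiring.Mult as Mult
import Algebra.Properties.Semiring.Sum as Sum
import Algebra.Solver.Ring.NaturalCoefficients.Default as SemiringSolver
open import Algebra.Structures using (IsCommutativeRing)
open import Data.Bool.Base using (if_then_else_)
open import Data.Digit using (Bit; 0b; 1b)
open import Data.Fin.Base using (Fin; zero; suc; toℕ; fromℕ<; punchOut)
open import Data.Fin.Properties using (toℕ-injective; toℕ<n; toℕ-fromℕ<; pigeonhole; punchOut-injective)
open import Data.Integer.Base as ℤ using (ℤ; +_; 0ℤ; 1ℤ; _%ℕ_; _/ℕ_)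
import Data.Integer.DivMod as ℤ
import Data.Integer.Divisibility.Signed as ℤ∣
import Data.Integer.Properties as ℤ
open import Data.Integer.Solver renaming (module +-*-Solver to ℤSolver)
open import Data.List.Base using (List; lookup; filter; map; upTo)
open import Data.List.Membership.Propositional using (_∈_)
open import Data.List.Membership.Propositional.Properties using (∈-filter⁺; ∈-filter⁻; ∈-map⁺; ∈-map⁻; ∈-upTo⁺; ∈-upTo⁻; ∈-lookup)
import Data.List.Relation.Unary.All as All
open import Data.List.Relation.Unary.AllPairs using (_∷_)
open import Data.List.Relation.Unary.Any using (index)
open import Data.List.Relation.Unary.Any.Properties using (lookup-index)
open import Data.List.Relation.Unary.Unique.Propositional using (Unique)
import Data.List.Relation.Unary.Unique.Propositional.Properties as Unique
open import Data.Nat.Base as ℕ using (ℕ; zero; suc; _≤_; _<_; _%_; _/_; _!; _∸_; NonZero; NonTrivial)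
open import Data.Nat.Combinatorics using (_C_; nC1≡n; nCk+nC[k+1]≡[n+1]C[k+1]; k>n⇒nCk≡0; nCk≡n!/k![n-k]!; k![n∸k]!∣n!)
open import Data.Nat.Coprimality using (Coprime; coprime?; coprime-Bézout)
open import Data.Nat.DivMod using (_mod_; m≡m%n+[m/n]*n; m%n<n; m/n<m; m/n*n≤m; m/n*n≡m; m<n⇒m%n≡m)
open import Data.Nat.Divisibility using (_∤_)
import Data.Nat.Divisibility as ℕ∣
open import Data.Nat.GCD using (module Bézout)
open import Data.Nat.Primality using (Prime; euclidsLemma; ¬prime[0]; ¬prime[1])
import Data.Nat.Properties as ℕ
open import Data.Nat.Solver renaming (module +-*-Solver to ℕSolver)
open import Data.Product.Base using (∃-syntax; _×_; _,_; proj₁; proj₂)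
open import Data.Sum.Base as Sum⊎ using (_⊎_; inj₁; inj₂; [_,_]′)
open import Function.Base using (_∘_)
open import Function.Bundles using (Bijection)
open import Level using (0ℓ)
open import Relation.Binary.Definitions using (Decidable; tri<; tri≈; tri>)
open import Relation.Binary.PropositionalEquality as ≡ using (_≡_; _≢_; _≗_; setoid)
import Relation.Binary.Reasoning.Setoid as Reasoning
open import Relation.Nullary.Decidable using (Dec; yes; no; does; map′)
open import Relation.Nullary.Negation using (¬_; contradiction)
open import Relation.Unary using (_≐_; ｛_｝)

-- Both claims are instances of `decimation-shift-trivial`: if s_{T i} = s_{i + D} for all i and T
-- is invertible modulo n, then T ≡ 1. An equation t S = S + c yields this with T = t and D = c / t;
-- a shift by ℓ between the decimations by t and u yields it with T = t / u and D = ℓ u, once i is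
-- replaced by i / u.
--
-- The obstacle is that the image j of l under multiplication by t is unknown, and with it both h_j
-- and γ^j. The element δ removes the second unknown, since γ^j = δ^l. The first disappears because
-- only the position of j relative to m matters: above m the coefficient is a sign, and the sign
-- depends on l alone, as t is odd; below m the pair is negated. The point j = m is excluded, being
-- the image of m itself. So each l strictly between 0 and m leaves two possible equations for δ. As
-- 2 m = - 1 in the field, h_1 and h_2 are the same rational constants for all p. Using l = 2 needs
-- 2 < m, which is why the smallest primes stand apart.

-- The ring of integers modulo `p`

module Congruence (p : ℕ) where

  infix 4 _≈_

  -- Wrapped in a record so that `x` and `y` can be recovered from the type, which the difference
  -- alone would not allow.
  record _≈_ (x y : ℤ) : Set where
    constructor congruent
    field difference : + p ℤ∣.∣ x ℤ.- y

  open _≈_ public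

  open ℤSolver

  ≡⇒≈ : ∀ {x y} → x ≡ y → x ≈ y
  ≡⇒≈ {x} ≡.refl = congruent (ℤ∣.divides 0ℤ (ℤ.+-inverseʳ x))

  private
    ≈-sym : ∀ {x y} → x ≈ y → y ≈ x
    ≈-sym {x} {y} (congruent d) = congruent (≡.subst (+ p ℤ∣.∣_)
      (solve 2 (λ x y → :- (x :- y) := y :- x) ≡.refl x y) (ℤ∣.∣m⇒∣-m d))

    ≈-trans : ∀ {x y z} → x ≈ y → y ≈ z → x ≈ z
    ≈-trans {x} {y} {z} (congruent d) (congruent e) = congruent (≡.subst (+ p ℤ∣.∣_)
      (solve 3 (λ x y z → (x :- y) :+ (y :- z) := x :- z) ≡.refl x y z) (ℤ∣.∣m∣n⇒∣m+n d e))

    +-cong : ∀ {x y u v} → x ≈ y → u ≈ v → x ℤ.+ u ≈ y ℤ.+ v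
    +-cong {x} {y} {u} {v} (congruent d) (congruent e) = congruent (≡.subst (+ p ℤ∣.∣_)
      (solve 4 (λ x y u v → (x :- y) :+ (u :- v) := (x :+ u) :- (y :+ v)) ≡.refl x y u v)
      (ℤ∣.∣m∣n⇒∣m+n d e))

    *-cong : ∀ {x y u v} → x ≈ y → u ≈ v → x ℤ.* u ≈ y ℤ.* v
    *-cong {x} {y} {u} {v} (congruent d) (congruent e) = congruent (≡.subst (+ p ℤ∣.∣_)
      (solve 4 (λ x y u v → u :* (x :- y) :+ y :* (u :- v) := (x :* u) :- (y :* v)) ≡.refl x y u v)
      (ℤ∣.∣m∣n⇒∣m+n (ℤ∣.∣n⇒∣m*n u d) (ℤ∣.∣n⇒∣m*n y e)))

    neg-cong : ∀ {x y} → x ≈ y → ℤ.- x ≈ ℤ.- y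
    neg-cong {x} {y} (congruent d) = congruent (≡.subst (+ p ℤ∣.∣_)
      (solve 2 (λ x y → :- (x :- y) := (:- x) :- (:- y)) ≡.refl x y) (ℤ∣.∣m⇒∣-m d))

    isCommutativeRing : IsCommutativeRing _≈_ ℤ._+_ ℤ._*_ ℤ.-_ 0ℤ 1ℤ
    isCommutativeRing = record
      { isRing = record
        { +-isAbelianGroup = record
          { isGroup = record
            { isMonoid = record
              { isSemigroup = record
                { isMagma = record
                  { isEquivalence = record { refl = ≡⇒≈ ≡.refl ; sym = ≈-sym ; trans = ≈-trans }
                  ; ∙-cong = +-cong
                  }
                ; assoc = λ x y z → ≡⇒≈ (ℤ.+-assoc x y z)
                }
              ; identity = (λ x → ≡⇒≈ (ℤ.+-identityˡ x)) , (λ x → ≡⇒≈ (ℤ.+-identityʳ x))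
              }
            ; inverse = (λ x → ≡⇒≈ (ℤ.+-inverseˡ x)) , (λ x → ≡⇒≈ (ℤ.+-inverseʳ x))
            ; ⁻¹-cong = neg-cong
            }
          ; comm = λ x y → ≡⇒≈ (ℤ.+-comm x y)
          }
        ; *-cong = *-cong
        ; *-assoc = λ x y z → ≡⇒≈ (ℤ.*-assoc x y z)
        ; *-identity = (λ x → ≡⇒≈ (ℤ.*-identityˡ x)) , (λ x → ≡⇒≈ (ℤ.*-identityʳ x))
        ; distrib = (λ x y z → ≡⇒≈ (ℤ.*-distribˡ-+ x y z)) , (λ x y z → ≡⇒≈ (ℤ.*-distribʳ-+ x y z))
        }
      ; *-comm = λ x y → ≡⇒≈ (ℤ.*-comm x y)
      }

  ring : CommutativeRing 0ℓ 0ℓ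
  ring = record { isCommutativeRing = isCommutativeRing }

  _≈?_ : Decidable _≈_
  x ≈? y = map′ congruent difference (+ p ℤ∣.∣? x ℤ.- y)

  ∣⇒≈0 : ∀ {k} → p ℕ∣.∣ k → + k ≈ 0ℤ
  ∣⇒≈0 {k} d = congruent (≡.subst (+ p ℤ∣.∣_) (≡.sym (ℤ.+-identityʳ (+ k))) (ℤ∣.∣ᵤ⇒∣ d))

  ≈0⇒∣ : ∀ {k} → + k ≈ 0ℤ → p ℕ∣.∣ k
  ≈0⇒∣ {k} (congruent d) = ℤ∣.∣⇒∣ᵤ (≡.subst (+ p ℤ∣.∣_) (ℤ.+-identityʳ (+ k)) d)

  integral : Prime p → ∀ x y → x ℤ.* y ≈ 0ℤ → x ≈ 0ℤ ⊎ y ≈ 0ℤ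
  integral p-prime x y (congruent d) = Sum⊎.map lift lift
    (euclidsLemma ℤ.∣ x ∣ ℤ.∣ y ∣ p-prime
      (≡.subst (p ℕ∣.∣_) (≡.trans (≡.cong ℤ.∣_∣ (ℤ.+-identityʳ (x ℤ.* y))) (ℤ.abs-* x y)) (ℤ∣.∣⇒∣ᵤ d)))
    where
    lift : ∀ {x} → p ℕ∣.∣ ℤ.∣ x ∣ → x ≈ 0ℤ
    lift {x} d = congruent (≡.subst (+ p ℤ∣.∣_) (≡.sym (ℤ.+-identityʳ x)) (ℤ∣.∣ᵤ⇒∣ d))

-- Geometric sums and the binomial theorem

module PowerSums (R : CommutativeRing 0ℓ 0ℓ) where

  open CommutativeRing R hiding (ring; zero)
  open Power commutativeSemiring
  open Mult semiring using (×-congˡ; ×-homo-+) renaming (_×_ to _·_)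
  open Sum semiring
  open Reasoning (CommutativeRing.setoid R)
  open SemiringSolver commutativeSemiring

  sum-single : ∀ {n} (f : Fin n → Carrier) k → (∀ i → i ≢ k → f i ≈ 0#) → sum f ≈ f k
  sum-single {suc n} f zero    f≈0 = begin
    f zero + sum (f ∘ suc)    ≈⟨ +-congˡ (sum-cong-≋ (λ i → f≈0 (suc i) λ ())) ⟩
    f zero + (∑[ i < n ] 0#)  ≈⟨ +-congˡ (sum-replicate-zero n) ⟩
    f zero + 0#               ≈⟨ +-identityʳ _ ⟩
    f zero                    ∎
  sum-single {suc n} f (suc k) f≈0 = begin
    f zero + sum (f ∘ suc)  ≈⟨ +-cong (f≈0 zero λ ())
                                 (sum-single (f ∘ suc) k λ i i≢k → f≈0 (suc i) λ { ≡.refl → i≢k ≡.refl }) ⟩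
    0# + f (suc k)          ≈⟨ +-identityˡ _ ⟩
    f (suc k)               ∎

  1^n≈1 : ∀ n → 1# ^ n ≈ 1#
  1^n≈1 zero    = refl
  1^n≈1 (suc n) = trans (*-identityˡ _) (1^n≈1 n)

  -- The familiar (z - 1) s = z^n - 1 with the subtractions moved across, which keeps it within the
  -- reach of the semiring solver.
  geometric-sum : ∀ n z → z * (∑[ i < n ] (z ^ toℕ i)) + 1# ≈ (∑[ i < n ] (z ^ toℕ i)) + z ^ n
  geometric-sum zero    z = +-congʳ (zeroʳ z)
  geometric-sum (suc n) z = begin
    z * (1# + (∑[ i < n ] (z * z ^ toℕ i))) + 1#
      ≈⟨ +-congʳ (*-congˡ (+-congˡ (sym (*-distribˡ-sum {n} z _)))) ⟩
    z * (1# + z * s) + 1#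
      ≈⟨ solve 2 (λ z s → z :* (con 1 :+ z :* s) :+ con 1 := z :* (z :* s :+ con 1) :+ con 1) refl z s ⟩
    z * (z * s + 1#) + 1#
      ≈⟨ +-congʳ (*-congˡ (geometric-sum n z)) ⟩
    z * (s + z ^ n) + 1#
      ≈⟨ solve 3 (λ z s t → z :* (s :+ t) :+ con 1 := (con 1 :+ z :* s) :+ z :* t) refl z s (z ^ n) ⟩
    (1# + z * s) + z * z ^ n
      ≈⟨ +-congʳ (+-congˡ (*-distribˡ-sum {n} z _)) ⟩
    (1# + (∑[ i < n ] (z * z ^ toℕ i))) + z * z ^ n ∎
    where s = ∑[ i < n ] (z ^ toℕ i)

  sum-of-powers-of-one : ∀ n {z} → z ≈ 1# → (∑[ i < n ] (z ^ toℕ i)) ≈ n · 1#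
  sum-of-powers-of-one n {z} z≈1 = begin
    (∑[ i < n ] (z ^ toℕ i)) ≈⟨ sum-cong-≋ {n} (λ i → trans (^-congˡ (toℕ i) z≈1) (1^n≈1 (toℕ i))) ⟩
    (∑[ i < n ] 1#)          ≈⟨ sum-replicate n ⟩
    n · 1#                   ∎

  -- Absorbing the weight `w ^ i` into the bases prepares the extraction of a Fourier coefficient:
  -- `w` is chosen so that the wanted base becomes 1.
  weighted-sum : ∀ {n} {f : Fin n → Carrier} (c g : Fin n → Carrier) w i →
    (∀ j → f j ≈ c j * g j ^ i) →
    (∑[ j < n ] f j) * w ^ i ≈ (∑[ j < n ] (c j * (w * g j) ^ i))
  weighted-sum {n} {f} c g w i f≈ = begin
    (∑[ j < n ] f j) * w ^ i
      ≈⟨ *-distribʳ-sum {n} (w ^ i) f ⟩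
    (∑[ j < n ] (f j * w ^ i))
      ≈⟨ sum-cong-≋ {n} (λ j → begin
           f j * w ^ i                ≈⟨ *-congʳ (f≈ j) ⟩
           c j * g j ^ i * w ^ i      ≈⟨ solve 3 (λ a b d → a :* b :* d := a :* (d :* b)) refl _ _ _ ⟩
           c j * (w ^ i * g j ^ i)    ≈⟨ *-congˡ (sym (^-distrib-* w (g j) i)) ⟩
           c j * (w * g j) ^ i        ∎) ⟩
    (∑[ j < n ] (c j * (w * g j) ^ i)) ∎

  -- The sum is padded beyond `m` by vanishing coefficients, so that it runs over the same `n`
  -- exponents as a Fourier sum.
  binomial-expansion : ∀ {m n} → m ℕ.< n → ∀ x →
    (1# + x) ^ m ≈ (∑[ j < n ] ((m C toℕ j) · 1# * x ^ toℕ j))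
  binomial-expansion {zero} {suc n} _ x = sym (begin
    (∑[ j < suc n ] ((0 C toℕ j) · 1# * x ^ toℕ j))
      ≈⟨ sum-single {suc n} (λ j → (0 C toℕ j) · 1# * x ^ toℕ j) zero
           (λ { zero i≢0 → contradiction ≡.refl i≢0 ; (suc _) _ → zeroˡ _ }) ⟩
    (1# + 0#) * 1# ≈⟨ solve 0 ((con 1 :+ con 0) :* con 1 := con 1) refl ⟩
    1# ∎)
  binomial-expansion {suc m} {suc n} (ℕ.s≤s m<n) x = begin
    (1# + x) * (1# + x) ^ m
      ≈⟨ solve 2 (λ x y → (con 1 :+ x) :* y := x :* y :+ y) refl x ((1# + x) ^ m) ⟩
    x * (1# + x) ^ m + (1# + x) ^ m
      -- The same power is expanded to two lengths: multiplied by `x`, the sum of `n` terms lines up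
      -- with the tail of the sum of `suc n` terms, and Pascal's rule adds them.
      ≈⟨ +-cong (*-congˡ (binomial-expansion m<n x)) (binomial-expansion (ℕ.m<n⇒m<1+n m<n) x) ⟩
    x * sum low + (1C + sum high)
      ≈⟨ +-congʳ (*-distribˡ-sum {n} x low) ⟩
    xlow + (1C + sum high)
      ≈⟨ solve 3 (λ r s t → r :+ (s :+ t) := s :+ (r :+ t)) refl xlow 1C (sum high) ⟩
    1C + (xlow + sum high)
      ≈⟨ +-congˡ (sym (∑-distrib-+ {n} (λ j → x * low j) high)) ⟩
    1C + (∑[ j < n ] (x * low j + high j))
      ≈⟨ +-congˡ (sum-cong-≋ {n} (pascal ∘ toℕ)) ⟩
    1C + (∑[ j < n ] ((suc m C suc (toℕ j)) · 1# * x ^ suc (toℕ j))) ∎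
    where
    low high : Fin n → Carrier
    low  j = (m C toℕ j) · 1# * x ^ toℕ j
    high j = (m C suc (toℕ j)) · 1# * x ^ suc (toℕ j)
    xlow = ∑[ j < n ] (x * low j)
    1C = (m C 0) · 1# * 1#
    pascal : ∀ k → x * ((m C k) · 1# * x ^ k) + (m C suc k) · 1# * (x * x ^ k) ≈ (suc m C suc k) · 1# * (x * x ^ k)
    pascal k = begin
      x * ((m C k) · 1# * x ^ k) + (m C suc k) · 1# * (x * x ^ k)
        ≈⟨ solve 4 (λ x y c d → x :* (c :* y) :+ d :* (x :* y) := (c :+ d) :* (x :* y)) refl
             x (x ^ k) ((m C k) · 1#) ((m C suc k) · 1#) ⟩
      ((m C k) · 1# + (m C suc k) · 1#) * (x * x ^ k)
        ≈⟨ *-congʳ (sym (×-homo-+ 1# (m C k) (m C suc k))) ⟩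
      (m C k ℕ.+ m C suc k) · 1# * (x * x ^ k)
        ≈⟨ *-congʳ (×-congˡ (nCk+nC[k+1]≡[n+1]C[k+1] m k)) ⟩
      (suc m C suc k) · 1# * (x * x ^ k) ∎

-- Integral domains and primitive elements

record IntegralDomain (R : CommutativeRing 0ℓ 0ℓ) : Set where

  open CommutativeRing R

  field
    integral : ∀ x y → x * y ≈ 0# → x ≈ 0# ⊎ y ≈ 0#
    1≉0      : ¬ 1# ≈ 0#
    _≈?_     : Decidable _≈_

-- R is a field with n + 1 elements and multiplicative generator α.
record PrimitiveElement (R : CommutativeRing 0ℓ 0ℓ) (n : ℕ) : Set where

  open CommutativeRing R
  open Power commutativeSemiring
  open Mult semiring using () renaming (_×_ to _·_)

  field
    α             : Carrier
    α≉0           : ¬ α ≈ 0#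
    α^n≈1         : α ^ n ≈ 1#
    order-minimal : ∀ {d} → 0 < d → α ^ d ≈ 1# → n ≤ d
    log           : ∀ x → ¬ x ≈ 0# → ∃[ k ] α ^ k ≈ x
    1+n≈0         : suc n · 1# ≈ 0#

module DomainPowers (R : CommutativeRing 0ℓ 0ℓ) (domain : IntegralDomain R) where

  open IntegralDomain domain
  open CommutativeRing R hiding (ring; zero)
  open Power commutativeSemiring
  open RingProperties (CommutativeRing.ring R)
  open Reasoning (CommutativeRing.setoid R)
  open PowerSums R using (1^n≈1)

  *-cancelˡ-≉0 : ∀ {x y z} → ¬ x ≈ 0# → x * y ≈ x * z → y ≈ z
  *-cancelˡ-≉0 {x} {y} {z} x≉0 xy≈xz with integral x (y - z) (trans (x[y-z]≈xy-xz x y z) (x≈y⇒x∙y⁻¹≈ε xy≈xz))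
  ... | inj₁ x≈0   = contradiction x≈0 x≉0
  ... | inj₂ y-z≈0 = x∙y⁻¹≈ε⇒x≈y y z y-z≈0

  ^-≉0 : ∀ {x} → ¬ x ≈ 0# → ∀ k → ¬ x ^ k ≈ 0#
  ^-≉0 x≉0 zero    1≈0  = 1≉0 1≈0
  ^-≉0 x≉0 (suc k) xᵏ≈0 = [ x≉0 , ^-≉0 x≉0 k ]′ (integral _ _ xᵏ≈0)

  ^-swap : ∀ x i j → (x ^ i) ^ j ≈ (x ^ j) ^ i
  ^-swap x i j = begin
    (x ^ i) ^ j      ≈⟨ ^-assocʳ x i j ⟩
    x ^ (i ℕ.* j)    ≡⟨ ≡.cong (x ^_) (ℕ.*-comm i j) ⟩
    x ^ (j ℕ.* i)    ≈⟨ sym (^-assocʳ x j i) ⟩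
    (x ^ j) ^ i      ∎

  ^-% : ∀ {x d} .{{_ : NonZero d}} → x ^ d ≈ 1# → ∀ k → x ^ (k % d) ≈ x ^ k
  ^-% {x} {d} x^d≈1 k = sym (begin
    x ^ k                              ≡⟨ ≡.cong (x ^_) (m≡m%n+[m/n]*n k d) ⟩
    x ^ (k % d ℕ.+ k / d ℕ.* d)        ≈⟨ ^-homo-* x (k % d) (k / d ℕ.* d) ⟩
    x ^ (k % d) * x ^ (k / d ℕ.* d)    ≈⟨ *-congˡ (sym (^-assocʳ x (k / d) d)) ⟩
    x ^ (k % d) * (x ^ (k / d)) ^ d    ≈⟨ *-congˡ (^-swap x (k / d) d) ⟩
    x ^ (k % d) * (x ^ d) ^ (k / d)    ≈⟨ *-congˡ (trans (^-congˡ (k / d) x^d≈1) (1^n≈1 (k / d))) ⟩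
    x ^ (k % d) * 1#                   ≈⟨ *-identityʳ _ ⟩
    x ^ (k % d)                        ∎)

module CyclicGroup (R : CommutativeRing 0ℓ 0ℓ) (domain : IntegralDomain R)
  (n : ℕ) .{{_ : NonZero n}} (generator : PrimitiveElement R n) where

  open PrimitiveElement generator
  open CommutativeRing R hiding (ring; zero)
  open Power commutativeSemiring
  open Reasoning (CommutativeRing.setoid R)
  open PowerSums R using (1^n≈1)
  open DomainPowers R domain

  α^≉0 : ∀ k → ¬ α ^ k ≈ 0#
  α^≉0 = ^-≉0 α≉0

  ^n≈1 : ∀ {x} → ¬ x ≈ 0# → x ^ n ≈ 1#
  ^n≈1 {x} x≉0 with log x x≉0
  ... | k , αᵏ≈x = begin
    x ^ n        ≈⟨ ^-congˡ n (sym αᵏ≈x) ⟩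
    (α ^ k) ^ n  ≈⟨ ^-swap α k n ⟩
    (α ^ n) ^ k  ≈⟨ ^-congˡ k α^n≈1 ⟩
    1# ^ k       ≈⟨ 1^n≈1 k ⟩
    1#           ∎

  α^% : ∀ k → α ^ (k % n) ≈ α ^ k
  α^% = ^-% α^n≈1

  -- Congruence of exponents modulo n is expressed as equality of powers of α.
  ^-cong-exponent : ∀ {x} → ¬ x ≈ 0# → ∀ {i j} → α ^ i ≈ α ^ j → x ^ i ≈ x ^ j
  ^-cong-exponent {x} x≉0 {i} {j} αⁱ≈αʲ with log x x≉0
  ... | k , αᵏ≈x = begin
    x ^ i        ≈⟨ ^-congˡ i (sym αᵏ≈x) ⟩
    (α ^ k) ^ i  ≈⟨ ^-swap α k i ⟩
    (α ^ i) ^ k  ≈⟨ ^-congˡ k αⁱ≈αʲ ⟩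
    (α ^ j) ^ k  ≈⟨ ^-swap α j k ⟩
    (α ^ k) ^ j  ≈⟨ ^-congˡ j αᵏ≈x ⟩
    x ^ j        ∎

  complement : ∀ {x k} → k < n → ¬ x ≈ 0# → x ^ k * x ^ (n ℕ.∸ k) ≈ 1#
  complement {x} {k} k<n x≉0 = begin
    x ^ k * x ^ (n ℕ.∸ k)  ≈⟨ sym (^-homo-* x k (n ℕ.∸ k)) ⟩
    x ^ (k ℕ.+ (n ℕ.∸ k))  ≡⟨ ≡.cong (x ^_) (ℕ.m+[n∸m]≡n (ℕ.<⇒≤ k<n)) ⟩
    x ^ n                  ≈⟨ ^n≈1 x≉0 ⟩
    1#                     ∎

  α^-≉1 : ∀ {k} → 0 < k → k < n → ¬ α ^ k ≈ 1#
  α^-≉1 0<k k<n αᵏ≈1 = ℕ.<⇒≱ k<n (order-minimal 0<k αᵏ≈1)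

  α^-distinct : ∀ {i j} → i < j → j < n → ¬ α ^ i ≈ α ^ j
  α^-distinct {i} {j} i<j j<n αⁱ≈αʲ = α^-≉1 (ℕ.m<n⇒0<n∸m i<j) (ℕ.≤-<-trans (ℕ.m∸n≤m j i) j<n)
    (*-cancelˡ-≉0 (α^≉0 i) (begin
      α ^ i * α ^ (j ℕ.∸ i)  ≈⟨ sym (^-homo-* α i (j ℕ.∸ i)) ⟩
      α ^ (i ℕ.+ (j ℕ.∸ i))  ≡⟨ ≡.cong (α ^_) (ℕ.m+[n∸m]≡n (ℕ.<⇒≤ i<j)) ⟩
      α ^ j                  ≈⟨ sym αⁱ≈αʲ ⟩
      α ^ i                  ≈⟨ sym (*-identityʳ _) ⟩
      α ^ i * 1#             ∎))

  α^-injective : ∀ {i j} → i < n → j < n → α ^ i ≈ α ^ j → i ≡ j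
  α^-injective {i} {j} i<n j<n αⁱ≈αʲ with ℕ.<-cmp i j
  ... | tri< i<j _ _ = contradiction αⁱ≈αʲ (α^-distinct i<j j<n)
  ... | tri≈ _ i≡j _ = i≡j
  ... | tri> _ _ j<i = contradiction (sym αⁱ≈αʲ) (α^-distinct j<i i<n)

-- Fourier analysis on the group generated by a primitive element

module Spectrum (R : CommutativeRing 0ℓ 0ℓ) (domain : IntegralDomain R)
  (n : ℕ) .{{_ : NonZero n}} (generator : PrimitiveElement R n)
  (m : ℕ) (n≡m+m : n ≡ m ℕ.+ m) where

  open IntegralDomain domain
  open PrimitiveElement generator
  open CommutativeRing R hiding (ring; zero)
  open Power commutativeSemiring
  open Mult semiring using () renaming (_×_ to _·_)
  open RingProperties (CommutativeRing.ring R)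
  open Sum semiring
  open Reasoning (CommutativeRing.setoid R)
  open PowerSums R
  open DomainPowers R domain
  open CyclicGroup R domain n generator
  open SemiringSolver commutativeSemiring using (solve; _:*_; _:+_; _:=_; con)

  0<m : 0 < m
  0<m = ℕ.n≢0⇒n>0 λ { ≡.refl → ℕ.≢-nonZero⁻¹ n n≡m+m }

  m<n : m < n
  m<n = ≡.subst (m <_) (≡.sym n≡m+m) (ℕ.m<m+n m 0<m)

  m<n∸k : ∀ {k} → k < m → m < n ℕ.∸ k
  m<n∸k {k} k<m rewrite n≡m+m | ℕ.+-∸-assoc m (ℕ.<⇒≤ k<m) = ℕ.m<m+n m (ℕ.m<n⇒0<n∸m k<m)

  x*x≈1⇒x≈±1 : ∀ {x} → x * x ≈ 1# → x ≈ 1# ⊎ x ≈ - 1#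
  x*x≈1⇒x≈±1 {x} xx≈1 with (x + 1#) ≈? 0#
  ... | yes x+1≈0 = inj₂ (+-inverseˡ-unique x 1# x+1≈0)
  ... | no  x+1≉0 = inj₁ (*-cancelˡ-≉0 x+1≉0 (begin
    (x + 1#) * x   ≈⟨ solve 1 (λ x → (x :+ con 1) :* x := x :* x :+ x) refl x ⟩
    x * x + x      ≈⟨ +-congʳ xx≈1 ⟩
    1# + x         ≈⟨ solve 1 (λ x → con 1 :+ x := (x :+ con 1) :* con 1) refl x ⟩
    (x + 1#) * 1#  ∎))

  α^m≈-1 : α ^ m ≈ - 1#
  α^m≈-1 with x*x≈1⇒x≈±1 (begin
    α ^ m * α ^ m  ≈⟨ sym (^-homo-* α m m) ⟩
    α ^ (m ℕ.+ m)  ≡⟨ ≡.cong (α ^_) (≡.sym n≡m+m) ⟩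
    α ^ n          ≈⟨ α^n≈1 ⟩
    1#             ∎)
  ... | inj₁ α^m≈1  = contradiction α^m≈1 (α^-≉1 0<m m<n)
  ... | inj₂ α^m≈-1 = α^m≈-1

  -1≉1 : ¬ - 1# ≈ 1#
  -1≉1 -1≈1 = α^-≉1 0<m m<n (trans α^m≈-1 -1≈1)

  -1≉0 : ¬ - 1# ≈ 0#
  -1≉0 -1≈0 = α^≉0 m (trans α^m≈-1 -1≈0)

  -1*-1≈1 : - 1# * - 1# ≈ 1#
  -1*-1≈1 = trans (-1*x≈-x (- 1#)) (-‿involutive 1#)

  -- In `R` the number `n` is - 1. The factor `n` that `orthogonality` produces can therefore be
  -- cancelled.
  n×1≉0 : ¬ n · 1# ≈ 0#
  n×1≉0 n×1≈0 = 1≉0 (begin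
    1#          ≈⟨ sym (+-identityʳ 1#) ⟩
    1# + 0#     ≈⟨ +-congˡ (sym n×1≈0) ⟩
    suc n · 1#  ≈⟨ 1+n≈0 ⟩
    0#          ∎)

  -- The Fourier coefficient h_k of `χ`, by `χ-expansion`.
  coefficient : ℕ → Carrier
  coefficient k = (m C k) · 1# - (- 1#) ^ k

  coefficient-high : ∀ {k} → m < k → coefficient k ≈ - (- 1#) ^ k
  coefficient-high {k} m<k rewrite k>n⇒nCk≡0 m<k = +-identityˡ _

  -- Because `z ^ n` is 1, the sum is fixed by multiplication with `z`; if it were nonzero,
  -- cancelling it would give `z ≈ 1#`.
  sum-of-powers≈0 : ∀ {z} → ¬ z ≈ 0# → ¬ z ≈ 1# → (∑[ i < n ] (z ^ toℕ i)) ≈ 0#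
  sum-of-powers≈0 {z} z≉0 z≉1 with (∑[ i < n ] (z ^ toℕ i)) ≈? 0#
  ... | yes s≈0 = s≈0
  ... | no  s≉0 = contradiction (*-cancelˡ-≉0 s≉0 (+-cancelʳ 1# _ _ (begin
    s * z + 1#   ≈⟨ +-congʳ (*-comm s z) ⟩
    z * s + 1#   ≈⟨ geometric-sum n z ⟩
    s + z ^ n    ≈⟨ +-cong (sym (*-identityʳ s)) (^n≈1 z≉0) ⟩
    s * 1# + 1#  ∎))) z≉1
    where s = ∑[ i < n ] (z ^ toℕ i)

  -- Exchanging the sums leaves one geometric sum for each base, and only the base equal to 1
  -- contributes. The bases are arbitrary because both the shifted and the decimated sequence have
  -- to be treated, with powers of `α` and of `τ`.
  orthogonality : (c u : Fin n → Carrier) (k : Fin n) → (∀ j → ¬ u j ≈ 0#) →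
    u k ≈ 1# → (∀ j → j ≢ k → ¬ u j ≈ 1#) →
    (∑[ i < n ] ∑[ j < n ] (c j * u j ^ toℕ i)) ≈ c k * n · 1#
  orthogonality c u k u≉0 uk≈1 u≉1 = begin
    (∑[ i < n ] ∑[ j < n ] (c j * u j ^ toℕ i))
      ≈⟨ ∑-comm {n} {n} (λ i j → c j * u j ^ toℕ i) ⟩
    (∑[ j < n ] ∑[ i < n ] (c j * u j ^ toℕ i))
      ≈⟨ sum-cong-≋ {n} (λ j → sym (*-distribˡ-sum {n} (c j) (λ i → u j ^ toℕ i))) ⟩
    (∑[ j < n ] (c j * (∑[ i < n ] (u j ^ toℕ i))))
      ≈⟨ sum-single {n} _ k (λ j j≢k → trans (*-congˡ (sum-of-powers≈0 (u≉0 j) (u≉1 j j≢k))) (zeroʳ _)) ⟩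
    c k * (∑[ i < n ] (u k ^ toℕ i))
      ≈⟨ *-congˡ (sum-of-powers-of-one n uk≈1) ⟩
    c k * n · 1# ∎

  module Character
    (binomial≉0 : ∀ {k} → k ≤ m → ¬ (m C k) · 1# ≈ 0#)
    (χ : ℕ → Carrier)
    (χ-zero : ∀ i → 1# + α ^ i ≈ 0# → χ i ≈ 1#)
    (χ-log : ∀ i k → α ^ k ≈ 1# + α ^ i → χ i ≈ (- 1#) ^ k)
    where

    -- As a function on the group ⟨α⟩, χ is the polynomial (1 + x) ^ m corrected at
    -- its zero x = - 1 by the indicator - ∑ (- x) ^ j.
    χ-expansion : ∀ i → χ i ≈ (∑[ j < n ] (coefficient (toℕ j) * (α ^ i) ^ toℕ j))
    χ-expansion i = trans (values ((1# + x) ≈? 0#)) (sym split)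
      where
      x = α ^ i
      z = - 1# * x
      z≉0 : ¬ z ≈ 0#
      z≉0 z≈0 = [ -1≉0 , α^≉0 i ]′ (integral _ _ z≈0)
      geometric = ∑[ j < n ] (z ^ toℕ j)

      term : ∀ k → coefficient k * x ^ k ≈ (m C k) · 1# * x ^ k + - 1# * z ^ k
      term k = begin
        ((m C k) · 1# - (- 1#) ^ k) * x ^ k
          ≈⟨ distribʳ _ _ _ ⟩
        (m C k) · 1# * x ^ k + - (- 1#) ^ k * x ^ k
          ≈⟨ +-congˡ (*-congʳ (sym (-1*x≈-x _))) ⟩
        (m C k) · 1# * x ^ k + - 1# * (- 1#) ^ k * x ^ k
          ≈⟨ +-congˡ (trans (*-assoc _ _ _) (*-congˡ (sym (^-distrib-* (- 1#) x k)))) ⟩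
        (m C k) · 1# * x ^ k + - 1# * z ^ k ∎

      split : (∑[ j < n ] (coefficient (toℕ j) * x ^ toℕ j)) ≈ (1# + x) ^ m + - 1# * geometric
      split = begin
        (∑[ j < n ] (coefficient (toℕ j) * x ^ toℕ j))
          ≈⟨ sum-cong-≋ {n} (term ∘ toℕ) ⟩
        (∑[ j < n ] ((m C toℕ j) · 1# * x ^ toℕ j + - 1# * z ^ toℕ j))
          ≈⟨ ∑-distrib-+ {n} (λ j → (m C toℕ j) · 1# * x ^ toℕ j) (λ j → - 1# * z ^ toℕ j) ⟩
        (∑[ j < n ] ((m C toℕ j) · 1# * x ^ toℕ j)) + (∑[ j < n ] (- 1# * z ^ toℕ j))
          ≈⟨ +-cong (sym (binomial-expansion m<n x)) (sym (*-distribˡ-sum {n} (- 1#) _)) ⟩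
        (1# + x) ^ m + - 1# * geometric ∎

      0^m≈0 : ∀ {m} → 0 < m → 0# ^ m ≈ 0#
      0^m≈0 {suc m} _ = zeroˡ _

      values : _ → χ i ≈ (1# + x) ^ m + - 1# * geometric
      -- Here `z` is 1 and the geometric sum is `n`, that is - 1; its negative supplies the value 1
      -- that the vanishing power misses.
      values (yes 1+x≈0) = begin
        χ i                              ≈⟨ χ-zero i 1+x≈0 ⟩
        1#                               ≈⟨ sym (-‿involutive 1#) ⟩
        - - 1#                           ≈⟨ -‿cong (sym (+-inverseʳ-unique 1# (n · 1#) 1+n≈0)) ⟩
        - (n · 1#)                       ≈⟨ sym (-1*x≈-x _) ⟩
        - 1# * n · 1#                    ≈⟨ *-congˡ (sym (sum-of-powers-of-one n z≈1)) ⟩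
        - 1# * geometric                 ≈⟨ sym (+-identityˡ _) ⟩
        0# + - 1# * geometric            ≈⟨ +-congʳ (sym (0^m≈0 0<m)) ⟩
        0# ^ m + - 1# * geometric        ≈⟨ +-congʳ (^-congˡ m (sym 1+x≈0)) ⟩
        (1# + x) ^ m + - 1# * geometric  ∎
        where
        z≈1 : z ≈ 1#
        z≈1 = trans (*-congˡ (+-inverseʳ-unique 1# x 1+x≈0)) -1*-1≈1
      values (no 1+x≉0) with log (1# + x) 1+x≉0
      ... | k , αᵏ≈1+x = begin
        χ i                              ≈⟨ χ-log i k αᵏ≈1+x ⟩
        -- Euler's criterion: with - 1 written as `α ^ m`, the sign is the `m`th power of 1 + x.
        (- 1#) ^ k                       ≈⟨ ^-congˡ k (sym α^m≈-1) ⟩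
        (α ^ m) ^ k                      ≈⟨ ^-swap α m k ⟩
        (α ^ k) ^ m                      ≈⟨ ^-congˡ m αᵏ≈1+x ⟩
        (1# + x) ^ m                     ≈⟨ sym (+-identityʳ _) ⟩
        (1# + x) ^ m + 0#                ≈⟨ +-congˡ (sym (zeroʳ _)) ⟩
        (1# + x) ^ m + - 1# * 0#         ≈⟨ +-congˡ (*-congˡ (sym (sum-of-powers≈0 z≉0 z≉1))) ⟩
        (1# + x) ^ m + - 1# * geometric  ∎
        where
        z≉1 : ¬ z ≈ 1#
        z≉1 z≈1 = 1+x≉0 (begin
          1# + x            ≈⟨ +-congˡ (begin
            x                   ≈⟨ sym (*-identityˡ x) ⟩
            1# * x              ≈⟨ *-congʳ (sym -1*-1≈1) ⟩
            - 1# * - 1# * x     ≈⟨ *-assoc _ _ _ ⟩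
            - 1# * z            ≈⟨ *-congˡ z≈1 ⟩
            - 1# * 1#           ≈⟨ *-identityʳ _ ⟩
            - 1#                ∎) ⟩
          1# - 1#           ≈⟨ -‿inverseʳ 1# ⟩
          0#                ∎)

    -- Decimations that coincide with a shift

    module Decimation (T S D : ℕ) (τ^S≈α : (α ^ T) ^ S ≈ α)
      (χ-shift : ∀ i → χ (T ℕ.* i) ≈ χ (i ℕ.+ D)) where

      τ γ : Carrier
      τ = α ^ T
      γ = α ^ D

      τ^-≉0 : ∀ l → ¬ τ ^ l ≈ 0#
      τ^-≉0 = ^-≉0 (α^≉0 T)

      τ^l^S≈α^l : ∀ l → (τ ^ l) ^ S ≈ α ^ l
      τ^l^S≈α^l l = trans (^-swap τ l S) (^-congˡ l τ^S≈α)

      -- `S` is an inverse of `T` modulo `n`, so raising to the power `S` undoes the decimation.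
      τ^-reflects : ∀ {k l} → τ ^ k ≈ τ ^ l → α ^ k ≈ α ^ l
      τ^-reflects {k} {l} τᵏ≈τˡ = trans (sym (τ^l^S≈α^l k)) (trans (^-congˡ S τᵏ≈τˡ) (τ^l^S≈α^l l))

      χ-shift-term : ∀ j i → ((α ^ (i ℕ.+ D)) ^ j) ≈ γ ^ j * (α ^ j) ^ i
      χ-shift-term j i = begin
        (α ^ (i ℕ.+ D)) ^ j      ≈⟨ ^-congˡ j (^-homo-* α i D) ⟩
        (α ^ i * γ) ^ j          ≈⟨ ^-distrib-* _ _ j ⟩
        (α ^ i) ^ j * γ ^ j      ≈⟨ *-congʳ (^-swap α i j) ⟩
        (α ^ j) ^ i * γ ^ j      ≈⟨ *-comm _ _ ⟩
        γ ^ j * (α ^ j) ^ i      ∎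

      χ-decimate-term : ∀ l i → ((α ^ (T ℕ.* i)) ^ l) ≈ (τ ^ l) ^ i
      χ-decimate-term l i = trans (^-congˡ l (sym (^-assocʳ α T i))) (^-swap τ i l)

      -- The two sides are the coefficient of one sequence at the base `α ^ j`, read off in two
      -- ways: from `χ (i + D)`, whose coefficients carry the twist `γ ^ j`, and from `χ (T i)`,
      -- whose bases are powers of `τ`. Multiplying by `w ^ i`, with `w` the inverse of `α ^ j`, and
      -- summing over `i` isolates it up to the factor `n`.
      coefficient-transfer : ∀ {l j} → l < n → j < n → α ^ j ≈ τ ^ l →
        coefficient j * γ ^ j ≈ coefficient l
      coefficient-transfer {l} {j} l<n j<n αʲ≈τˡ = *-cancelˡ-≉0 n×1≉0 (begin
        n · 1# * (coefficient j * γ ^ j)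
          ≈⟨ *-comm _ _ ⟩
        coefficient j * γ ^ j * n · 1#
          ≡⟨ ≡.cong (λ j → coefficient j * γ ^ j * n · 1#) (≡.sym (toℕ-fromℕ< j<n)) ⟩
        shiftC j′ * n · 1#
          ≈⟨ sym (orthogonality shiftC shiftU j′ (λ k → *-≉0 w≉0 (α^≉0 (toℕ k)))
               (trans (*-congˡ (reflexive (≡.cong (α ^_) (toℕ-fromℕ< j<n)))) wαʲ≈1)
               (λ i i≢j′ u≈1 → i≢j′ (toℕ-injective (≡.trans
                 (α^-injective (toℕ<n i) j<n (*-cancelˡ-≉0 w≉0 (trans u≈1 (sym wαʲ≈1))))
                 (≡.sym (toℕ-fromℕ< j<n)))))) ⟩
        (∑[ i < n ] ∑[ k < n ] (shiftC k * shiftU k ^ toℕ i))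
          ≈⟨ sum-cong-≋ {n} (λ i → sym (weighted-sum shiftC (λ k → α ^ toℕ k) w (toℕ i) (λ k →
               trans (*-congˡ (χ-shift-term (toℕ k) (toℕ i))) (sym (*-assoc _ _ _))))) ⟩
        (∑[ i < n ] ((∑[ k < n ] (coefficient (toℕ k) * (α ^ (toℕ i ℕ.+ D)) ^ toℕ k)) * w ^ toℕ i))
          -- Here the hypothesis `χ-shift` enters: both expansions belong to the same sequence.
          ≈⟨ sum-cong-≋ {n} (λ i → *-congʳ (trans (sym (χ-expansion (toℕ i ℕ.+ D)))
               (trans (sym (χ-shift (toℕ i))) (χ-expansion (T ℕ.* toℕ i))))) ⟩
        (∑[ i < n ] ((∑[ k < n ] (coefficient (toℕ k) * (α ^ (T ℕ.* toℕ i)) ^ toℕ k)) * w ^ toℕ i))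
          ≈⟨ sum-cong-≋ {n} (λ i → weighted-sum decC (λ k → τ ^ toℕ k) w (toℕ i) (λ k → *-congˡ (χ-decimate-term (toℕ k) (toℕ i)))) ⟩
        (∑[ i < n ] ∑[ k < n ] (decC k * decU k ^ toℕ i))
          ≈⟨ orthogonality decC decU l′ (λ k → *-≉0 w≉0 (τ^-≉0 (toℕ k)))
               (trans (*-congˡ (reflexive (≡.cong (τ ^_) (toℕ-fromℕ< l<n)))) wτˡ≈1)
               (λ i i≢l′ u≈1 → i≢l′ (toℕ-injective (≡.trans
                 (α^-injective (toℕ<n i) l<n (τ^-reflects {toℕ i} {l} (*-cancelˡ-≉0 w≉0 (trans u≈1 (sym wτˡ≈1)))))
                 (≡.sym (toℕ-fromℕ< l<n))))) ⟩
        decC l′ * n · 1#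
          ≡⟨ ≡.cong (λ l → coefficient l * n · 1#) (toℕ-fromℕ< l<n) ⟩
        coefficient l * n · 1#
          ≈⟨ *-comm _ _ ⟩
        n · 1# * coefficient l ∎)
        where
        *-≉0 : ∀ {x y} → ¬ x ≈ 0# → ¬ y ≈ 0# → ¬ x * y ≈ 0#
        *-≉0 x≉0 y≉0 xy≈0 = [ x≉0 , y≉0 ]′ (integral _ _ xy≈0)
        w = α ^ (n ℕ.∸ j)
        w≉0 : ¬ w ≈ 0#
        w≉0 = α^≉0 (n ℕ.∸ j)
        wαʲ≈1 : w * α ^ j ≈ 1#
        wαʲ≈1 = begin
          w * α ^ j              ≈⟨ sym (^-homo-* α (n ℕ.∸ j) j) ⟩
          α ^ (n ℕ.∸ j ℕ.+ j)    ≡⟨ ≡.cong (α ^_) (ℕ.m∸n+n≡m (ℕ.<⇒≤ j<n)) ⟩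
          α ^ n                  ≈⟨ α^n≈1 ⟩
          1#                     ∎
        wτˡ≈1 : w * τ ^ l ≈ 1#
        wτˡ≈1 = trans (*-congˡ (sym αʲ≈τˡ)) wαʲ≈1
        j′ = fromℕ< j<n
        l′ = fromℕ< l<n
        shiftC shiftU decC decU : Fin n → Carrier
        shiftC k = coefficient (toℕ k) * γ ^ toℕ k
        shiftU k = w * α ^ toℕ k
        decC k = coefficient (toℕ k)
        decU k = w * τ ^ toℕ k

      -- `T` is odd, being invertible modulo the even `n`. In terms of powers: the sign `(- 1#) ^ T`
      -- has `S`th power - 1, so it cannot be 1.
      [-1]^T≈-1 : (- 1#) ^ T ≈ - 1#
      [-1]^T≈-1 = [ (λ σ≈1 → contradiction (begin
          - 1#                ≈⟨ sym [-1]^T^S≈-1 ⟩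
          ((- 1#) ^ T) ^ S    ≈⟨ ^-congˡ S σ≈1 ⟩
          1# ^ S              ≈⟨ 1^n≈1 S ⟩
          1#                  ∎) -1≉1) , (λ σ≈-1 → σ≈-1) ]′
        (x*x≈1⇒x≈±1 (begin
          (- 1#) ^ T * (- 1#) ^ T  ≈⟨ sym (^-distrib-* _ _ T) ⟩
          (- 1# * - 1#) ^ T        ≈⟨ ^-congˡ T -1*-1≈1 ⟩
          1# ^ T                   ≈⟨ 1^n≈1 T ⟩
          1#                       ∎))
        where
        [-1]^T^S≈-1 : ((- 1#) ^ T) ^ S ≈ - 1#
        [-1]^T^S≈-1 = begin
          ((- 1#) ^ T) ^ S   ≈⟨ ^-assocʳ (- 1#) T S ⟩
          (- 1#) ^ (T ℕ.* S) ≈⟨ ^-cong-exponent -1≉0 {T ℕ.* S} {1} (trans (sym (^-assocʳ α T S))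
                                  (trans τ^S≈α (sym (*-identityʳ α)))) ⟩
          - 1# * 1#          ≈⟨ *-identityʳ _ ⟩
          - 1#               ∎

      τ^m≈-1 : τ ^ m ≈ - 1#
      τ^m≈-1 = trans (^-swap α T m) (trans (^-congˡ T α^m≈-1) [-1]^T≈-1)

      ^-transfer : ∀ {x} → ¬ x ≈ 0# → ∀ l j → α ^ j ≈ τ ^ l → x ^ j ≈ (x ^ T) ^ l
      ^-transfer {x} x≉0 l j αʲ≈τˡ = trans
        (^-cong-exponent x≉0 {j} {T ℕ.* l} (trans αʲ≈τˡ (^-assocʳ α T l))) (sym (^-assocʳ x T l))

      sign-transfer : ∀ l j → α ^ j ≈ τ ^ l → (- 1#) ^ j ≈ (- 1#) ^ l
      sign-transfer l j αʲ≈τˡ = trans (^-transfer -1≉0 l j αʲ≈τˡ) (^-congˡ l [-1]^T≈-1)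

      δ : Carrier
      δ = γ ^ T

      δ≈1⇒γ≈1 : δ ≈ 1# → γ ≈ 1#
      δ≈1⇒γ≈1 δ≈1 = begin
        γ             ≈⟨ sym (*-identityʳ γ) ⟩
        γ ^ 1         ≈⟨ ^-cong-exponent (α^≉0 D) {1} {T ℕ.* S} (trans (*-identityʳ α) (trans (sym τ^S≈α) (^-assocʳ α T S))) ⟩
        γ ^ (T ℕ.* S) ≈⟨ sym (^-assocʳ γ T S) ⟩
        δ ^ S         ≈⟨ ^-congˡ S δ≈1 ⟩
        1# ^ S        ≈⟨ 1^n≈1 S ⟩
        1#            ∎

      -- If l and its image j both lie below m, their negatives both lie above m, where
      -- the coefficients are - (- 1) ^ k and the transfer becomes an equation for γ alone.
      both-low⇒γ^j≈1 : ∀ {l j} → 0 < l → l < m → 0 < j → j < m → α ^ j ≈ τ ^ l → γ ^ j ≈ 1#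
      both-low⇒γ^j≈1 {l} {j} 0<l l<m 0<j j<m αʲ≈τˡ = begin
        γ ^ j            ≈⟨ sym (*-identityʳ _) ⟩
        γ ^ j * 1#       ≈⟨ *-congˡ (sym γ^j′≈1) ⟩
        γ ^ j * γ ^ j′   ≈⟨ complement j<n (α^≉0 D) ⟩
        1#               ∎
        where
        l<n = ℕ.<-trans l<m m<n
        j<n = ℕ.<-trans j<m m<n
        l′ = n ℕ.∸ l
        j′ = n ℕ.∸ j
        l′<n : l′ < n
        l′<n = ℕ.∸-monoʳ-< 0<l (ℕ.<⇒≤ l<n)
        j′<n : j′ < n
        j′<n = ℕ.∸-monoʳ-< 0<j (ℕ.<⇒≤ j<n)
        αʲ′≈τˡ′ : α ^ j′ ≈ τ ^ l′
        αʲ′≈τˡ′ = *-cancelˡ-≉0 (τ^-≉0 l) (begin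
          τ ^ l * α ^ j′  ≈⟨ *-congʳ (sym αʲ≈τˡ) ⟩
          α ^ j * α ^ j′  ≈⟨ complement j<n α≉0 ⟩
          1#              ≈⟨ sym (complement l<n (α^≉0 T)) ⟩
          τ ^ l * τ ^ l′  ∎)
        γ^j′≈1 : γ ^ j′ ≈ 1#
        γ^j′≈1 = *-cancelˡ-≉0 (λ c≈0 → ^-≉0 -1≉0 j′ (trans (sym (-‿involutive _))
                   (trans (-‿cong (trans (sym (coefficient-high (m<n∸k j<m))) c≈0)) -0#≈0#))) (begin
          coefficient j′ * γ ^ j′  ≈⟨ coefficient-transfer l′<n j′<n αʲ′≈τˡ′ ⟩
          coefficient l′           ≈⟨ coefficient-high (m<n∸k l<m) ⟩
          - (- 1#) ^ l′            ≈⟨ -‿cong (sym (sign-transfer l′ j′ αʲ′≈τˡ′)) ⟩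
          - (- 1#) ^ j′            ≈⟨ sym (coefficient-high (m<n∸k j<m)) ⟩
          coefficient j′           ≈⟨ sym (*-identityʳ _) ⟩
          coefficient j′ * 1#      ∎)

      image-exponent : ∀ l → α ^ ((T ℕ.* l) % n) ≈ τ ^ l
      image-exponent l = trans (α^% (T ℕ.* l)) (sym (^-assocʳ α T l))

      -- The alternatives are the image exponent lying below or above `m`. It is not `m`, because
      -- `T` is odd and so `τ ^ m` is already - 1. Using `δ ^ l` for `γ ^ j` makes the outcome
      -- independent of the image exponent, so that different `l` constrain one unknown.
      dichotomy : ∀ {l} → 0 < l → l < m → δ ^ l ≈ 1# ⊎ - (- 1#) ^ l * δ ^ l ≈ coefficient l
      dichotomy {l} 0<l l<m with ℕ.<-cmp ((T ℕ.* l) % n) m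
      ... | tri< j<m _ _ = inj₁ (trans (sym (^-transfer (α^≉0 D) l ((T ℕ.* l) % n) αʲ≈τˡ)) (both-low⇒γ^j≈1 0<l l<m 0<j j<m αʲ≈τˡ))
        where
        αʲ≈τˡ = image-exponent l
        0<j : 0 < (T ℕ.* l) % n
        0<j = ℕ.n≢0⇒n>0 λ j≡0 → α^-≉1 0<l (ℕ.<-trans l<m m<n)
          (τ^-reflects {l} {0} (trans (sym αʲ≈τˡ) (reflexive (≡.cong (α ^_) j≡0))))
      ... | tri≈ _ j≡m _ = contradiction
        (τ^-reflects {l} {m} (trans (sym (image-exponent l)) (trans (reflexive (≡.cong (α ^_) j≡m))
          (trans α^m≈-1 (sym τ^m≈-1)))))
        (α^-distinct l<m m<n)
      ... | tri> _ _ m<j = inj₂ (begin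
        - (- 1#) ^ l * δ ^ l   ≈⟨ *-cong (-‿cong (sym (sign-transfer l j αʲ≈τˡ))) (sym (^-transfer (α^≉0 D) l j αʲ≈τˡ)) ⟩
        - (- 1#) ^ j * γ ^ j   ≈⟨ *-congʳ (sym (coefficient-high m<j)) ⟩
        coefficient j * γ ^ j  ≈⟨ coefficient-transfer (ℕ.<-trans l<m m<n) (m%n<n (T ℕ.* l) n) αʲ≈τˡ ⟩
        coefficient l          ∎)
        where
        j = (T ℕ.* l) % n
        αʲ≈τˡ = image-exponent l

      γ≉1⇒δ≈coefficient1 : ¬ γ ≈ 1# → 1 < m → δ ≈ coefficient 1
      γ≉1⇒δ≈coefficient1 γ≉1 1<m with dichotomy ℕ.≤-refl 1<m
      ... | inj₁ δ¹≈1 = contradiction (δ≈1⇒γ≈1 (trans (sym (*-identityʳ δ)) δ¹≈1)) γ≉1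
      ... | inj₂ eq   = begin
        δ                           ≈⟨ sym (*-identityʳ δ) ⟩
        δ ^ 1                       ≈⟨ sym (*-identityˡ _) ⟩
        1# * δ ^ 1                  ≈⟨ *-congʳ (sym (-‿involutive 1#)) ⟩
        - - 1# * δ ^ 1              ≈⟨ *-congʳ (-‿cong (sym (*-identityʳ _))) ⟩
        - (- 1#) ^ 1 * δ ^ 1        ≈⟨ eq ⟩
        coefficient 1               ∎

      square-dichotomy : 2 < m → δ * δ ≈ 1# ⊎ - (δ * δ) ≈ coefficient 2
      square-dichotomy 2<m with dichotomy (ℕ.s≤s ℕ.z≤n) 2<m
      ... | inj₁ δ²≈1 = inj₁ (trans (sym (*-congˡ (*-identityʳ δ))) δ²≈1)
      ... | inj₂ eq   = inj₂ (begin
        - (δ * δ)                   ≈⟨ sym (-1*x≈-x _) ⟩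
        - 1# * (δ * δ)              ≈⟨ *-cong (-‿cong (sym (trans (*-congˡ (*-identityʳ _)) -1*-1≈1)))
                                         (*-congˡ (sym (*-identityʳ δ))) ⟩
        - (- 1#) ^ 2 * δ ^ 2        ≈⟨ eq ⟩
        coefficient 2               ∎)

      -- Without the twist the coefficients themselves agree, and their sign parts cancel by
      -- `sign-transfer`.
      binomial-transfer : γ ≈ 1# → ∀ {l j} → l < n → j < n → α ^ j ≈ τ ^ l → (m C j) · 1# ≈ (m C l) · 1#
      binomial-transfer γ≈1 {l} {j} l<n j<n αʲ≈τˡ = +-cancelʳ (- (- 1#) ^ j) _ _ (begin
        coefficient j           ≈⟨ sym (*-identityʳ _) ⟩
        coefficient j * 1#      ≈⟨ *-congˡ (sym (trans (^-congˡ j γ≈1) (1^n≈1 j))) ⟩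
        coefficient j * γ ^ j   ≈⟨ coefficient-transfer l<n j<n αʲ≈τˡ ⟩
        coefficient l           ≈⟨ +-congˡ (-‿cong (sym (sign-transfer l j αʲ≈τˡ))) ⟩
        (m C l) · 1# - (- 1#) ^ j ∎)

      -- For t ≥ 2 the multiple of t just above m lies in (m , 2 m]: there the binomial
      -- coefficients of m vanish, while that of its preimage does not.
      γ≈1⇒τ≈α : γ ≈ 1# → τ ≈ α
      γ≈1⇒τ≈α γ≈1 = from-exponent (T % n) (m%n<n T n) (α^% T)
        where
        vanishing : ∀ {l j} → l ≤ m → m < j → j < n → ¬ α ^ j ≈ τ ^ l
        vanishing {l} {j} l≤m m<j j<n αʲ≈τˡ = binomial≉0 l≤m (begin
          (m C l) · 1#  ≈⟨ sym (binomial-transfer γ≈1 (ℕ.≤-<-trans l≤m m<n) j<n αʲ≈τˡ) ⟩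
          (m C j) · 1#  ≡⟨ ≡.cong (_· 1#) (k>n⇒nCk≡0 m<j) ⟩
          0#            ∎)

        no-small-exponent : ∀ t → 1 < t → t ≤ m → ¬ α ^ t ≈ τ
        no-small-exponent t@(suc _) 1<t t≤m αᵗ≈τ with ℕ.m≤n⇒m<n∨m≡n k*t≤n
          where
          k*t≤n : suc (m / t) ℕ.* t ≤ n
          k*t≤n = ≡.subst (suc (m / t) ℕ.* t ≤_) (≡.sym n≡m+m) (ℕ.+-mono-≤ t≤m (m/n*n≤m m t))
        ... | inj₁ k*t<n = vanishing k≤m m<k*t k*t<n αᵏᵗ≈τᵏ
          where
          k = suc (m / t)
          k≤m : k ≤ m
          k≤m = m/n<m m t {{ℕ.>-nonZero 0<m}} 1<t
          m<k*t : m < k ℕ.* t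
          m<k*t = ≡.subst (_< k ℕ.* t) (≡.sym (m≡m%n+[m/n]*n m t)) (ℕ.+-monoˡ-< (m / t ℕ.* t) (m%n<n m t))
          αᵏᵗ≈τᵏ : α ^ (k ℕ.* t) ≈ τ ^ k
          αᵏᵗ≈τᵏ = trans (sym (^-assocʳ α k t)) (trans (^-swap α k t) (^-congˡ k αᵗ≈τ))
        -- A multiple equal to `n` wraps around to the exponent 0, where `vanishing` says nothing.
        -- But then `τ ^ k` is 1 for a positive `k` below `n`, although `τ` generates the same group
        -- as `α`.
        ... | inj₂ k*t≡n = α^-≉1 (ℕ.s≤s ℕ.z≤n) (ℕ.≤-<-trans k≤m m<n) (τ^-reflects {k} {0} (begin
            τ ^ k          ≈⟨ sym (^-congˡ k αᵗ≈τ) ⟩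
            (α ^ t) ^ k    ≈⟨ ^-swap α t k ⟩
            (α ^ k) ^ t    ≈⟨ ^-assocʳ α k t ⟩
            α ^ (k ℕ.* t)  ≡⟨ ≡.cong (α ^_) k*t≡n ⟩
            α ^ n          ≈⟨ α^n≈1 ⟩
            1#             ∎))
          where
          k = suc (m / t)
          k≤m : k ≤ m
          k≤m = m/n<m m t {{ℕ.>-nonZero 0<m}} 1<t

        from-exponent : ∀ t → t < n → α ^ t ≈ τ → τ ≈ α
        from-exponent 0 _ α⁰≈τ = contradiction (τ^-reflects {1} {0} (trans (*-identityʳ τ) (sym α⁰≈τ)))
          (α^-≉1 ℕ.≤-refl (ℕ.≤-<-trans 0<m m<n))
        from-exponent 1 _ α¹≈τ = trans (sym α¹≈τ) (*-identityʳ α)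
        from-exponent t@(suc (suc _)) t<n αᵗ≈τ with t ℕ.≤? m
        -- The image of 1 already lies above `m`, so no further multiple is needed.
        ... | no t≰m  = contradiction (trans αᵗ≈τ (sym (*-identityʳ τ))) (vanishing 0<m (ℕ.≰⇒> t≰m) t<n)
        ... | yes t≤m = contradiction αᵗ≈τ (no-small-exponent t (ℕ.s≤s (ℕ.s≤s ℕ.z≤n)) t≤m)

-- Canonical residues as integers modulo `n`

toℕ-mod : ∀ a n .{{_ : NonZero n}} → toℕ (a mod n) ≡ a % n
toℕ-mod a n = toℕ-fromℕ< (m%n<n a n)

module ResidueMap (n : ℕ) .{{_ : NonZero n}} where

  open Congruence n
  open CommutativeRing ring using (refl; sym; trans; +-cong)
  open Residues n using (1#; 0#) renaming (_+_ to _⊞_; _*_ to _⊠_)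

  ι : Fin n → ℤ
  ι x = + toℕ x

  %ℕ-≈ : ∀ i → + (i %ℕ n) ≈ i
  %ℕ-≈ i = congruent (ℤ∣.divides (ℤ.- (i /ℕ n)) (begin
    + r ℤ.- i                  ≡⟨ ≡.cong (λ k → + r ℤ.- k) (ℤ.a≡a%ℕn+[a/ℕn]*n i n) ⟩
    + r ℤ.- (+ r ℤ.+ q ℤ.* + n) ≡⟨ solve 3 (λ r q n → r :- (r :+ q :* n) := (:- q) :* n) ≡.refl (+ r) q (+ n) ⟩
    (ℤ.- q) ℤ.* + n            ∎))
    where
    open ≡.≡-Reasoning
    open ℤSolver
    r = i %ℕ n
    q = i /ℕ n

  <⇒≉ : ∀ {a b} → a < b → b < n → ¬ + a ≈ + b
  <⇒≉ {a} {b} a<b b<n (congruent d) = ℕ.<⇒≱ (ℕ.≤-<-trans (ℕ.m∸n≤m b a) b<n)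
    (ℕ∣.∣⇒≤ {{ℕ.>-nonZero (ℕ.m<n⇒0<n∸m a<b)}}
      (≡.subst (n ℕ∣.∣_) (≡.trans (≡.cong ℤ.∣_∣ (ℤ.m-n≡m⊖n a b)) (ℤ.∣⊖∣-≤ (ℕ.<⇒≤ a<b))) (ℤ∣.∣⇒∣ᵤ d)))

  <-≈⇒≡ : ∀ {a b} → a < n → b < n → + a ≈ + b → a ≡ b
  <-≈⇒≡ {a} {b} a<n b<n a≈b with ℕ.<-cmp a b
  ... | tri< a<b _ _ = contradiction a≈b (<⇒≉ a<b b<n)
  ... | tri≈ _ a≡b _ = a≡b
  ... | tri> _ _ b<a = contradiction (sym a≈b) (<⇒≉ b<a a<n)

  ι-injective : ∀ {x y} → ι x ≈ ι y → x ≡ y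
  ι-injective {x} {y} = toℕ-injective ∘ <-≈⇒≡ (toℕ<n x) (toℕ<n y)

  ι-mod : ∀ a → ι (a mod n) ≈ + a
  ι-mod a = trans (≡⇒≈ (≡.cong +_ (toℕ-mod a n))) (%ℕ-≈ (+ a))

  ι-+ : ∀ x y → ι (x ⊞ y) ≈ ι x ℤ.+ ι y
  ι-+ x y = ι-mod _

  ι-* : ∀ x y → ι (x ⊠ y) ≈ ι x ℤ.* ι y
  ι-* x y = trans (ι-mod _) (≡⇒≈ (ℤ.pos-* (toℕ x) (toℕ y)))

  ι-0 : ι 0# ≈ 0ℤ
  ι-0 = ι-mod 0

  ι-1 : ι 1# ≈ 1ℤ
  ι-1 = ι-mod 1

  ι-surjective : ∀ i → ∃[ x ] ι x ≈ i
  ι-surjective i = fromℕ< (ℤ.n%ℕd<d i n) , trans (≡⇒≈ (≡.cong +_ (toℕ-fromℕ< (ℤ.n%ℕd<d i n)))) (%ℕ-≈ i)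

  -- Serves to replace a possibly negative shift by its residue, so that it can be used as an
  -- exponent.
  [+i+ℓ]%ℕ≡[i+ℓ%ℕ]% : ∀ i ℓ → (+ i ℤ.+ ℓ) %ℕ n ≡ (i ℕ.+ ℓ %ℕ n) % n
  [+i+ℓ]%ℕ≡[i+ℓ%ℕ]% i ℓ = <-≈⇒≡ (ℤ.n%ℕd<d (+ i ℤ.+ ℓ) n) (m%n<n (i ℕ.+ ℓ %ℕ n) n)
    (trans (%ℕ-≈ (+ i ℤ.+ ℓ)) (trans (+-cong {+ i} {+ i} {ℓ} {+ (ℓ %ℕ n)} refl (sym (%ℕ-≈ ℓ)))
      (sym (%ℕ-≈ (+ (i ℕ.+ ℓ %ℕ n))))))

-- Factorials, binomial coefficients and parity

prime∤! : ∀ {p} → Prime p → ∀ {m} → m < p → p ℕ∣.∤ m !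
prime∤! p-prime {zero}  _   p∣1 = ¬prime[1] (≡.subst Prime (ℕ∣.∣1⇒≡1 p∣1) p-prime)
prime∤! p-prime {suc m} m<p p∣m! with euclidsLemma (suc m) (m !) p-prime p∣m!
... | inj₁ p∣1+m = ℕ.<⇒≱ m<p (ℕ∣.∣⇒≤ p∣1+m)
... | inj₂ p∣m!′ = prime∤! p-prime (ℕ.<⇒≤ m<p) p∣m!′

-- The binomial coefficient is a divisor of `m !`, whose prime factors are all at most `m`.
prime∤C : ∀ {p} → Prime p → ∀ {m k} → m < p → k ≤ m → p ℕ∣.∤ m C k
prime∤C {p} p-prime {m} {k} m<p k≤m p∣C = prime∤! p-prime m<p (≡.subst (p ℕ∣.∣_) (begin
  (m C k) ℕ.* (k ! ℕ.* (m ℕ.∸ k) !)                                ≡⟨ ≡.cong (ℕ._* (k ! ℕ.* (m ℕ.∸ k) !)) (nCk≡n!/k![n-k]! k≤m) ⟩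
  (m ! / (k ! ℕ.* (m ℕ.∸ k) !)) ℕ.* (k ! ℕ.* (m ℕ.∸ k) !)          ≡⟨ m/n*n≡m (k![n∸k]!∣n! k≤m) ⟩
  m !                                                           ∎)
  (ℕ∣.∣m⇒∣m*n (k ! ℕ.* (m ℕ.∸ k) !) p∣C))
  where
  open ≡.≡-Reasoning
  instance _ = k ℕ.!* (m ℕ.∸ k) !≢0

even⊎odd : ∀ k → ∃[ q ] (k ≡ q ℕ.+ q ⊎ k ≡ suc (q ℕ.+ q))
even⊎odd zero = 0 , inj₁ ≡.refl
even⊎odd (suc k) with even⊎odd k
... | q , inj₁ k≡2q   = q , inj₂ (≡.cong suc k≡2q)
... | q , inj₂ k≡2q+1 = suc q , inj₁ (≡.cong suc (≡.trans k≡2q+1 (≡.sym (ℕ.+-suc q q))))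

-- The form of 2 C(n , 2) = n (n - 1) without division and truncated subtraction, which carries over
-- to multiples of `1#` in a ring.
nC2+nC2+n≡n*n : ∀ n → n C 2 ℕ.+ n C 2 ℕ.+ n ≡ n ℕ.* n
nC2+nC2+n≡n*n zero    = ≡.refl
nC2+nC2+n≡n*n (suc n) = begin
  suc n C 2 ℕ.+ suc n C 2 ℕ.+ suc n
    ≡⟨ ≡.cong (λ c → c ℕ.+ c ℕ.+ suc n) (≡.trans (≡.sym (nCk+nC[k+1]≡[n+1]C[k+1] n 1)) (≡.cong (ℕ._+ n C 2) (nC1≡n n))) ⟩
  (n ℕ.+ n C 2) ℕ.+ (n ℕ.+ n C 2) ℕ.+ suc n
    ≡⟨ solve 2 (λ n c → (n :+ c) :+ (n :+ c) :+ (con 1 :+ n) := (c :+ c :+ n) :+ (con 1 :+ (n :+ n))) ≡.refl n (n C 2) ⟩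
  (n C 2 ℕ.+ n C 2 ℕ.+ n) ℕ.+ suc (n ℕ.+ n)
    ≡⟨ ≡.cong (ℕ._+ suc (n ℕ.+ n)) (nC2+nC2+n≡n*n n) ⟩
  n ℕ.* n ℕ.+ suc (n ℕ.+ n)
    ≡⟨ solve 1 (λ n → n :* n :+ (con 1 :+ (n :+ n)) := (con 1 :+ n) :* (con 1 :+ n)) ≡.refl n ⟩
  suc n ℕ.* suc n ∎
  where
  open ≡.≡-Reasoning
  open ℕSolver

bit-extensional : ∀ {b c : Bit} → (b ≡ 1b → c ≡ 1b) → (c ≡ 1b → b ≡ 1b) → b ≡ c
bit-extensional {zero}     {zero}     _ _ = ≡.refl
bit-extensional {zero}     {suc zero} _ g = g ≡.refl
bit-extensional {suc zero} {zero}     f _ = ≡.sym (f ≡.refl)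
bit-extensional {suc zero} {suc zero} _ _ = ≡.refl

-- The SLCE sequence in a ring model of the residues

-- The operations on `Fin p` are raw; `ι` is an isomorphism onto a ring `R` where the laws are at
-- hand.
record ResidueModel (R : CommutativeRing 0ℓ 0ℓ) (p : ℕ) .{{_ : NonZero p}} : Set where

  open CommutativeRing R
  open Mult semiring using () renaming (_×_ to _·_)
  private module ℤ/p = Residues p

  field
    characteristic : ∀ {j} → j · 1# ≈ 0# → p ℕ∣.∣ j
    p≈0            : p · 1# ≈ 0#
    ι              : Fin p → Carrier
    ι-injective    : ∀ {x y} → ι x ≈ ι y → x ≡ y
    ι-surjective   : ∀ x → ∃[ y ] ι y ≈ x
    ι-+            : ∀ x y → ι (x ℤ/p.+ y) ≈ ι x + ι y
    ι-*            : ∀ x y → ι (x ℤ/p.* y) ≈ ι x * ι y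
    ι-0            : ι ℤ/p.0# ≈ 0#
    ι-1            : ι ℤ/p.1# ≈ 1#

module SLCESequence (R : CommutativeRing 0ℓ 0ℓ) (domain : IntegralDomain R)
  (k : ℕ) (p-prime : Prime (suc (suc k))) (model : ResidueModel R (suc (suc k)))
  (α : Fin (suc (suc k))) (α-primitive : SLCE.IsPrimitive (suc (suc k)) α) where

  n p : ℕ
  n = suc k
  p = suc n

  open SLCE p
  open IntegralDomain domain
  open ResidueModel model
  open CommutativeRing R hiding (ring; zero)
  open Power commutativeSemiring
  open Mult semiring using (×-homo-+; ×1-homo-*) renaming (_×_ to _·_)
  open RingProperties (CommutativeRing.ring R)
  open Reasoning (CommutativeRing.setoid R)
  open DomainPowers R domain
  open PowerSums R using (1^n≈1)

  A : Carrier
  A = ι α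

  ι-cong : ∀ {x y} → x ≡ y → ι x ≈ ι y
  ι-cong = reflexive ∘ ≡.cong ι

  ι-^ : ∀ x k → ι (x 𝔽.^ k) ≈ ι x ^ k
  ι-^ x zero    = ι-1
  ι-^ x (suc k) = trans (ι-* x (x 𝔽.^ k)) (*-congˡ (ι-^ x k))

  A≉0 : ¬ A ≈ 0#
  A≉0 A≈0 = proj₁ α-primitive (ι-injective (trans A≈0 (sym ι-0)))

  A^≉0 : ∀ k → ¬ A ^ k ≈ 0#
  A^≉0 = ^-≉0 A≉0

  log : ∀ x → ¬ x ≈ 0# → ∃[ k ] A ^ k ≈ x
  log x x≉0 with ι-surjective x
  ... | y , y≈x with proj₂ α-primitive y (λ y≡0 → x≉0 (trans (sym y≈x) (trans (ι-cong y≡0) ι-0)))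
  ... | k , αᵏ≡y = k , trans (sym (ι-^ α k)) (trans (ι-cong αᵏ≡y) y≈x)

  logSuc : ∀ (i : Fin n) → ∃[ k ] A ^ k ≈ ι (suc i)
  logSuc i = log (ι (suc i)) λ i≈0 → contradiction (ι-injective (trans i≈0 (sym ι-0))) λ ()

  -- With a smaller `d` all logarithms could be reduced modulo `d`, leaving fewer than `n` exponents
  -- for the `n` nonzero residues.
  order-minimal : ∀ {d} → 0 < d → A ^ d ≈ 1# → n ≤ d
  order-minimal {d@(suc _)} _ Aᵈ≈1 with n ℕ.≤? d
  ... | yes n≤d = n≤d
  ... | no  n≰d with pigeonhole (ℕ.≰⇒> n≰d) (λ i → proj₁ (logSuc i) mod d)
  ... | i , j , i<j , fᵢ≡fⱼ = contradiction (≡.cong toℕ (ι-injective (begin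
      ι (suc i)                              ≈⟨ sym (A^log i) ⟩
      A ^ toℕ (proj₁ (logSuc i) mod d)       ≡⟨ ≡.cong ((A ^_) ∘ toℕ) fᵢ≡fⱼ ⟩
      A ^ toℕ (proj₁ (logSuc j) mod d)       ≈⟨ A^log j ⟩
      ι (suc j)                              ∎)))
    (ℕ.<⇒≢ (ℕ.s<s i<j))
    where
    A^log : ∀ i → A ^ toℕ (proj₁ (logSuc i) mod d) ≈ ι (suc i)
    A^log i = begin
      A ^ toℕ (proj₁ (logSuc i) mod d)   ≡⟨ ≡.cong (A ^_) (toℕ-mod (proj₁ (logSuc i)) d) ⟩
      A ^ (proj₁ (logSuc i) % d)         ≈⟨ ^-% Aᵈ≈1 (proj₁ (logSuc i)) ⟩
      A ^ proj₁ (logSuc i)               ≈⟨ proj₂ (logSuc i) ⟩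
      ι (suc i)                          ∎

  0≢α^ : ∀ k → zero ≢ α 𝔽.^ k
  0≢α^ k 0≡αᵏ = A^≉0 k (trans (sym (ι-^ α k)) (trans (ι-cong (≡.sym 0≡αᵏ)) ι-0))

  -- Fermat's little theorem by the pigeonhole principle: the exponents 0 , ... , n yield only `n`
  -- values, as 0 is punched out. A coincidence at i < j makes the power with exponent j - i equal
  -- to 1, and `order-minimal` leaves only j - i = n.
  Aⁿ≈1 : A ^ n ≈ 1#
  Aⁿ≈1 with pigeonhole {n} {suc n} ℕ.≤-refl (λ i → punchOut (0≢α^ (toℕ i)))
  ... | i , j , i<j , fᵢ≡fⱼ = trans (reflexive (≡.cong (A ^_) n≡j-i)) Aʲ⁻ⁱ≈1
    where
    Aʲ⁻ⁱ≈1 : A ^ (toℕ j ℕ.∸ toℕ i) ≈ 1#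
    Aʲ⁻ⁱ≈1 = *-cancelˡ-≉0 (A^≉0 (toℕ i)) (begin
      A ^ toℕ i * A ^ (toℕ j ℕ.∸ toℕ i)    ≈⟨ sym (^-homo-* A (toℕ i) _) ⟩
      A ^ (toℕ i ℕ.+ (toℕ j ℕ.∸ toℕ i))    ≡⟨ ≡.cong (A ^_) (ℕ.m+[n∸m]≡n (ℕ.<⇒≤ i<j)) ⟩
      A ^ toℕ j                            ≈⟨ sym (ι-^ α (toℕ j)) ⟩
      ι (α 𝔽.^ toℕ j)                      ≈⟨ ι-cong (≡.sym (punchOut-injective (0≢α^ (toℕ i)) (0≢α^ (toℕ j)) fᵢ≡fⱼ)) ⟩
      ι (α 𝔽.^ toℕ i)                      ≈⟨ ι-^ α (toℕ i) ⟩
      A ^ toℕ i                            ≈⟨ sym (*-identityʳ _) ⟩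
      A ^ toℕ i * 1#                       ∎)
    n≡j-i : n ≡ toℕ j ℕ.∸ toℕ i
    n≡j-i = ℕ.≤-antisym (order-minimal (ℕ.m<n⇒0<n∸m i<j) Aʲ⁻ⁱ≈1)
      (ℕ.≤-trans (ℕ.m∸n≤m (toℕ j) (toℕ i)) (ℕ.s≤s⁻¹ (toℕ<n j)))

  generator : PrimitiveElement R n
  generator = record
    { α             = A
    ; α≉0           = A≉0
    ; α^n≈1         = Aⁿ≈1
    ; order-minimal = order-minimal
    ; log           = log
    ; 1+n≈0         = p≈0
    }

  open CyclicGroup R domain n generator

  slce-cong : ∀ i j → A ^ i ≈ A ^ j → slce α i ≡ slce α j
  slce-cong i j Aⁱ≈Aʲ = ≡.cong (λ x → if does (isSquare? (x 𝔽.+ 𝔽.1#)) then 0b else 1b)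
    (ι-injective (begin
      ι (α 𝔽.^ (i % n))  ≈⟨ ι-^ α (i % n) ⟩
      A ^ (i % n)        ≈⟨ α^% i ⟩
      A ^ i              ≈⟨ Aⁱ≈Aʲ ⟩
      A ^ j              ≈⟨ sym (α^% j) ⟩
      A ^ (j % n)        ≈⟨ sym (ι-^ α (j % n)) ⟩
      ι (α 𝔽.^ (j % n))  ∎))

  A^mod : ∀ a → A ^ toℕ (a mod n) ≈ A ^ a
  A^mod a = trans (reflexive (≡.cong (A ^_) (toℕ-mod a n))) (α^% a)

  A^+ : ∀ x y → A ^ toℕ (x Exp.+ y) ≈ A ^ toℕ x * A ^ toℕ y
  A^+ x y = trans (A^mod (toℕ x ℕ.+ toℕ y)) (^-homo-* A (toℕ x) (toℕ y))

  A^* : ∀ x y → A ^ toℕ (x Exp.* y) ≈ (A ^ toℕ x) ^ toℕ y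
  A^* x y = trans (A^mod (toℕ x ℕ.* toℕ y)) (sym (^-assocʳ A (toℕ x) (toℕ y)))

  A^0 : A ^ toℕ Exp.0# ≈ 1#
  A^0 = A^mod 0

  A^1 : A ^ toℕ Exp.1# ≈ A
  A^1 = trans (A^mod 1) (*-identityʳ A)

  A^toℕ-injective : ∀ {x y : Fin n} → A ^ toℕ x ≈ A ^ toℕ y → x ≡ y
  A^toℕ-injective {x} {y} = toℕ-injective ∘ α^-injective (toℕ<n x) (toℕ<n y)

  A^leastPositive : ∀ t → A ^ Exp.leastPositive t ≈ A ^ toℕ t
  A^leastPositive zero    = Aⁿ≈1
  A^leastPositive (suc _) = refl

  A^unit : ∀ {t u} → t Exp.* u ≡ Exp.1# → (A ^ toℕ t) ^ toℕ u ≈ A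
  A^unit {t} {u} tu≡1 = trans (sym (A^* t u)) (trans (reflexive (≡.cong (λ x → A ^ toℕ x) tu≡1)) A^1)

  1-multiplier : Exp.MultiplierGroup (slceSet α) Exp.1#
  1-multiplier = (Exp.1# , 1*x≡x Exp.1#) , Exp.0# ,
    (λ { (x , x∈S , eq) → x , x∈S , ≡.trans eq (≡.trans (1*x≡x x) (≡.sym (x+0≡x x))) }) ,
    (λ { (x , x∈S , eq) → x , x∈S , ≡.trans eq (≡.trans (x+0≡x x) (≡.sym (1*x≡x x))) })
    where
    1*x≡x : ∀ x → Exp.1# Exp.* x ≡ x
    1*x≡x x = A^toℕ-injective (trans (A^* Exp.1# x) (^-congˡ (toℕ x) A^1))
    x+0≡x : ∀ x → x Exp.+ Exp.0# ≡ x
    x+0≡x x = A^toℕ-injective (trans (A^+ x Exp.0#) (trans (*-congˡ A^0) (*-identityʳ _)))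

  module _ (m : ℕ) (n≡m+m : n ≡ m ℕ.+ m) where

    open Spectrum R domain n generator m n≡m+m

    sign : Bit → Carrier
    sign zero    = 1#
    sign (suc _) = - 1#

    sign-yes : ∀ {P : Set} (P? : Dec P) → P → sign (if does P? then 0b else 1b) ≈ 1#
    sign-yes (yes _) _ = refl
    sign-yes (no ¬P) P = contradiction P ¬P

    sign-no : ∀ {P : Set} (P? : Dec P) → ¬ P → sign (if does P? then 0b else 1b) ≈ - 1#
    sign-no (yes P) ¬P = contradiction P ¬P
    sign-no (no _)  _  = refl

    χ : ℕ → Carrier
    χ i = sign (slce α i)

    slceArgument : ℕ → Fin p
    slceArgument i = (α 𝔽.^ (i % n)) 𝔽.+ 𝔽.1#

    ι-slceArgument : ∀ i → ι (slceArgument i) ≈ 1# + A ^ i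
    ι-slceArgument i = begin
      ι (slceArgument i)            ≈⟨ ι-+ (α 𝔽.^ (i % n)) 𝔽.1# ⟩
      ι (α 𝔽.^ (i % n)) + ι 𝔽.1#   ≈⟨ +-cong (trans (ι-^ α (i % n)) (α^% i)) ι-1 ⟩
      A ^ i + 1#                    ≈⟨ +-comm _ _ ⟩
      1# + A ^ i                    ∎

    χ-zero : ∀ i → 1# + A ^ i ≈ 0# → χ i ≈ 1#
    χ-zero i 1+Aⁱ≈0 = sign-yes (isSquare? (slceArgument i)) (𝔽.0# , ι-injective (begin
      ι (𝔽.0# 𝔽.* 𝔽.0#)    ≈⟨ ι-* 𝔽.0# 𝔽.0# ⟩
      ι 𝔽.0# * ι 𝔽.0#      ≈⟨ *-congʳ ι-0 ⟩
      0# * ι 𝔽.0#           ≈⟨ zeroˡ _ ⟩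
      0#                    ≈⟨ sym 1+Aⁱ≈0 ⟩
      1# + A ^ i            ≈⟨ sym (ι-slceArgument i) ⟩
      ι (slceArgument i)    ∎))

    [-1]^even≈1 : ∀ q → (- 1#) ^ (q ℕ.+ q) ≈ 1#
    [-1]^even≈1 q = begin
      (- 1#) ^ (q ℕ.+ q)        ≈⟨ ^-homo-* (- 1#) q q ⟩
      (- 1#) ^ q * (- 1#) ^ q   ≈⟨ sym (^-distrib-* _ _ q) ⟩
      (- 1# * - 1#) ^ q         ≈⟨ ^-congˡ q -1*-1≈1 ⟩
      1# ^ q                    ≈⟨ 1^n≈1 q ⟩
      1#                        ∎

    -- The squares among the powers of a generator are those with even exponent, so the bit is the
    -- parity of a logarithm; which logarithm is immaterial, since `n` is even.
    χ-log : ∀ i k → A ^ k ≈ 1# + A ^ i → χ i ≈ (- 1#) ^ k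
    χ-log i k Aᵏ≈1+Aⁱ = [ even , odd ]′ (proj₂ (even⊎odd k))
      where
      q = proj₁ (even⊎odd k)

      even : k ≡ q ℕ.+ q → χ i ≈ (- 1#) ^ k
      even k≡2q = begin
        χ i                   ≈⟨ sign-yes (isSquare? (slceArgument i)) (α 𝔽.^ q , ι-injective (begin
          ι ((α 𝔽.^ q) 𝔽.* (α 𝔽.^ q))  ≈⟨ ι-* _ _ ⟩
          ι (α 𝔽.^ q) * ι (α 𝔽.^ q)    ≈⟨ *-cong (ι-^ α q) (ι-^ α q) ⟩
          A ^ q * A ^ q                ≈⟨ sym (^-homo-* A q q) ⟩
          A ^ (q ℕ.+ q)                ≡⟨ ≡.cong (A ^_) (≡.sym k≡2q) ⟩
          A ^ k                        ≈⟨ Aᵏ≈1+Aⁱ ⟩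
          1# + A ^ i                   ≈⟨ sym (ι-slceArgument i) ⟩
          ι (slceArgument i)           ∎)) ⟩
        1#                    ≈⟨ sym ([-1]^even≈1 q) ⟩
        (- 1#) ^ (q ℕ.+ q)    ≡⟨ ≡.cong ((- 1#) ^_) (≡.sym k≡2q) ⟩
        (- 1#) ^ k            ∎

      odd : k ≡ suc (q ℕ.+ q) → χ i ≈ (- 1#) ^ k
      odd k≡2q+1 = trans (sign-no (isSquare? (slceArgument i)) nonsquare) (sym [-1]^k≈-1)
        where
        [-1]^k≈-1 : (- 1#) ^ k ≈ - 1#
        [-1]^k≈-1 = begin
          (- 1#) ^ k                   ≡⟨ ≡.cong ((- 1#) ^_) k≡2q+1 ⟩
          - 1# * (- 1#) ^ (q ℕ.+ q)    ≈⟨ *-congˡ ([-1]^even≈1 q) ⟩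
          - 1# * 1#                    ≈⟨ *-identityʳ _ ⟩
          - 1#                         ∎

        -- A square root would have a logarithm `l`; then `k` and `l ℕ.+ l` are congruent modulo `n`
        -- and give the same power of - 1, although `k` is odd.
        nonsquare : ¬ IsSquare (slceArgument i)
        nonsquare (y , yy≡) = -1≉1 (begin
          - 1#                  ≈⟨ sym [-1]^k≈-1 ⟩
          (- 1#) ^ k            ≈⟨ ^-cong-exponent -1≉0 {k} {l ℕ.+ l} (sym (begin
            A ^ (l ℕ.+ l)         ≈⟨ ^-homo-* A l l ⟩
            A ^ l * A ^ l         ≈⟨ *-cong (proj₂ logy) (proj₂ logy) ⟩
            ι y * ι y             ≈⟨ ιy*ιy≈Aᵏ ⟩
            A ^ k                 ∎)) ⟩
          (- 1#) ^ (l ℕ.+ l)    ≈⟨ [-1]^even≈1 l ⟩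
          1#                    ∎)
          where
          ιy*ιy≈Aᵏ : ι y * ι y ≈ A ^ k
          ιy*ιy≈Aᵏ = begin
            ι y * ι y           ≈⟨ sym (ι-* y y) ⟩
            ι (y 𝔽.* y)         ≈⟨ ι-cong yy≡ ⟩
            ι (slceArgument i)  ≈⟨ ι-slceArgument i ⟩
            1# + A ^ i          ≈⟨ sym Aᵏ≈1+Aⁱ ⟩
            A ^ k               ∎
          logy : ∃[ l ] A ^ l ≈ ι y
          logy = log (ι y) λ ιy≈0 → A^≉0 k (trans (sym ιy*ιy≈Aᵏ) (trans (*-congʳ ιy≈0) (zeroˡ _)))
          l = proj₁ logy

    binomial≉0 : ∀ {k} → k ≤ m → ¬ (m C k) · 1# ≈ 0#
    binomial≉0 k≤m = prime∤C p-prime (ℕ.<-trans m<n ℕ.≤-refl) k≤m ∘ characteristic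

    open Character binomial≉0 χ χ-zero χ-log
    open SemiringSolver commutativeSemiring

    private
      x = m · 1#
      s = (m C 2) · 1#

      -- Spelled out as sums ending in `con 0`, so that they evaluate to the very terms `3 · 1#`,
      -- `4 · 1#` and `8 · 1#`.
      three four eight : ∀ {i} → Polynomial i
      three = con 1 :+ (con 1 :+ (con 1 :+ con 0))
      four  = con 1 :+ three
      eight = con 1 :+ (con 1 :+ (con 1 :+ (con 1 :+ four)))

    2x+1≈0 : x + x + 1# ≈ 0#
    2x+1≈0 = begin
      x + x + 1#             ≈⟨ +-comm _ _ ⟩
      1# + (x + x)           ≈⟨ +-congˡ (sym (×-homo-+ 1# m m)) ⟩
      1# + (m ℕ.+ m) · 1#    ≡⟨ ≡.cong (λ n → 1# + n · 1#) (≡.sym n≡m+m) ⟩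
      p · 1#                 ≈⟨ p≈0 ⟩
      0#                     ∎

    coefficient1 : coefficient 1 ≈ x + 1#
    coefficient1 = +-cong (reflexive (≡.cong (_· 1#) (nC1≡n m))) (trans (-‿cong (*-identityʳ _)) (-‿involutive 1#))

    2s+x≈x² : s + s + x ≈ x * x
    2s+x≈x² = begin
      s + s + x                        ≈⟨ +-congʳ (sym (×-homo-+ 1# (m C 2) (m C 2))) ⟩
      (m C 2 ℕ.+ m C 2) · 1# + x       ≈⟨ sym (×-homo-+ 1# (m C 2 ℕ.+ m C 2) m) ⟩
      (m C 2 ℕ.+ m C 2 ℕ.+ m) · 1#     ≡⟨ ≡.cong (_· 1#) (nC2+nC2+n≡n*n m) ⟩
      (m ℕ.* m) · 1#                   ≈⟨ ×1-homo-* m m ⟩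
      x * x                            ∎

    -- With 2 x = - 1 one has 4 (x + 1) ^ 2 = 1.
    [x+1]²≈1⇒3≈0 : (x + 1#) * (x + 1#) ≈ 1# → 3 · 1# ≈ 0#
    [x+1]²≈1⇒3≈0 eq = +-cancelʳ (4 · 1#) _ _ (begin
      3 · 1# + 4 · 1#
        ≈⟨ solve 0 (three :+ four := three :+ four :* con 1) refl ⟩
      3 · 1# + 4 · 1# * 1#
        ≈⟨ +-congˡ (*-congˡ (sym eq)) ⟩
      3 · 1# + 4 · 1# * ((x + 1#) * (x + 1#))
        ≈⟨ solve 1 (λ x → three :+ four :* ((x :+ con 1) :* (x :+ con 1))
                     := (x :+ x :+ con 1) :* (x :+ x :+ three) :+ four) refl x ⟩
      (x + x + 1#) * (x + x + 3 · 1#) + 4 · 1#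
        ≈⟨ +-congʳ (trans (*-congʳ 2x+1≈0) (zeroˡ _)) ⟩
      0# + 4 · 1# ∎)

    -- Here 8 (x + 1) ^ 2 + 8 s = 2 + 3, using 8 s = (2 x) ^ 2 - 2 (2 x) = 3.
    [x+1]²+s≈1⇒3≈0 : (x + 1#) * (x + 1#) + s ≈ 1# → 3 · 1# ≈ 0#
    -- The added `4 · 1# * x` completes 8 s to 4 (2 s + x), which `2s+x≈x²` turns into 4 x²;
    -- `8 · 1#` is 8 times the right side of `eq`.
    [x+1]²+s≈1⇒3≈0 eq = +-cancelʳ (8 · 1# + 4 · 1# * x) _ _ (begin
      3 · 1# + (8 · 1# + 4 · 1# * x)
        ≈⟨ solve 1 (λ x → three :+ (eight :+ four :* x) := three :+ eight :* con 1 :+ four :* x) refl x ⟩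
      3 · 1# + 8 · 1# * 1# + 4 · 1# * x
        ≈⟨ +-congʳ (+-congˡ (*-congˡ (sym eq))) ⟩
      3 · 1# + 8 · 1# * ((x + 1#) * (x + 1#) + s) + 4 · 1# * x
        ≈⟨ solve 2 (λ x s → three :+ eight :* ((x :+ con 1) :* (x :+ con 1) :+ s) :+ four :* x
                       := three :+ eight :* ((x :+ con 1) :* (x :+ con 1)) :+ four :* (s :+ s :+ x)) refl x s ⟩
      3 · 1# + 8 · 1# * ((x + 1#) * (x + 1#)) + 4 · 1# * (s + s + x)
        ≈⟨ +-congˡ (*-congˡ 2s+x≈x²) ⟩
      3 · 1# + 8 · 1# * ((x + 1#) * (x + 1#)) + 4 · 1# * (x * x)
        ≈⟨ solve 1 (λ x → three :+ eight :* ((x :+ con 1) :* (x :+ con 1)) :+ four :* (x :* x)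
                     := (x :+ x :+ con 1) :* (three :* (x :+ x :+ con 1)) :+ (eight :+ four :* x)) refl x ⟩
      (x + x + 1#) * (3 · 1# * (x + x + 1#)) + (8 · 1# + 4 · 1# * x)
        ≈⟨ +-congʳ (trans (*-congʳ 2x+1≈0) (zeroˡ _)) ⟩
      0# + (8 · 1# + 4 · 1# * x) ∎)

    module _ (T S D : ℕ) (τ^S≈A : (A ^ T) ^ S ≈ A)
      (shift : ∀ i → slce α (T ℕ.* i) ≡ slce α (i ℕ.+ D)) where

      private
        χ-shift : ∀ i → χ (T ℕ.* i) ≈ χ (i ℕ.+ D)
        χ-shift i = reflexive (≡.cong sign (shift i))

      open Decimation T S D τ^S≈A χ-shift

      private
        γ≉1⇒3≈0 : ¬ A ^ D ≈ 1# → 2 < m → 3 · 1# ≈ 0#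
        γ≉1⇒3≈0 γ≉1 2<m = [ [x+1]²≈1⇒3≈0 ∘ trans (sym δδ≈[x+1]²) , [x+1]²+s≈1⇒3≈0 ∘ rearrange ]′ (square-dichotomy 2<m)
          where
          δ≈x+1 : δ ≈ x + 1#
          δ≈x+1 = trans (γ≉1⇒δ≈coefficient1 γ≉1 (ℕ.<-trans ℕ.≤-refl 2<m)) coefficient1
          δδ≈[x+1]² : δ * δ ≈ (x + 1#) * (x + 1#)
          δδ≈[x+1]² = *-cong δ≈x+1 δ≈x+1
          rearrange : - (δ * δ) ≈ coefficient 2 → (x + 1#) * (x + 1#) + s ≈ 1#
          rearrange eq = begin
            (x + 1#) * (x + 1#) + s           ≈⟨ +-congʳ (sym δδ≈[x+1]²) ⟩
            δ * δ + s                         ≈⟨ +-congˡ (sym (+-identityʳ s)) ⟩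
            δ * δ + (s + 0#)                  ≈⟨ +-congˡ (+-congˡ (sym (-‿inverseˡ ((- 1#) ^ 2)))) ⟩
            δ * δ + (s + (- (- 1#) ^ 2 + (- 1#) ^ 2)) ≈⟨ +-congˡ (sym (+-assoc _ _ _)) ⟩
            δ * δ + (coefficient 2 + (- 1#) ^ 2)      ≈⟨ +-congˡ (+-congʳ (sym eq)) ⟩
            δ * δ + (- (δ * δ) + (- 1#) ^ 2)  ≈⟨ sym (+-assoc _ _ _) ⟩
            δ * δ - δ * δ + (- 1#) ^ 2        ≈⟨ +-cong (-‿inverseʳ _) ([-1]^even≈1 1) ⟩
            0# + 1#                           ≈⟨ +-identityˡ _ ⟩
            1#                                ∎

        3<p : 2 < m → 3 < p
        3<p 2<m = ℕ.<-trans (ℕ.≤-<-trans 2<m m<n) ℕ.≤-refl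

        γ≉1⇒2≮m : ¬ A ^ D ≈ 1# → ¬ 2 < m
        γ≉1⇒2≮m γ≉1 2<m = ℕ.<⇒≱ (3<p 2<m) (ℕ∣.∣⇒≤ (characteristic {3} (γ≉1⇒3≈0 γ≉1 2<m)))

        -- A fresh `m` is quantified so that it can be split. For `m` = 1 the generator is - 1 and
        -- is fixed because `T` is odd; `m` = 0 is impossible, as `n` is positive.
        m≤2⇒τ≈A : ∀ {m} → p ≢ 5 → m ≤ 2 → n ≡ m ℕ.+ m → A ^ m ≈ - 1# → A ^ T ≈ A
        m≤2⇒τ≈A {1} _ _ _ A¹≈-1 = begin
          A ^ T        ≈⟨ ^-congˡ T A≈-1 ⟩
          (- 1#) ^ T   ≈⟨ [-1]^T≈-1 ⟩
          - 1#         ≈⟨ sym A≈-1 ⟩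
          A            ∎
          where
          A≈-1 : A ≈ - 1#
          A≈-1 = trans (sym (*-identityʳ A)) A¹≈-1
        m≤2⇒τ≈A {2} p≢5 _ n≡4 _ = contradiction (≡.cong suc n≡4) p≢5
        m≤2⇒τ≈A {suc (suc (suc _))} _ (ℕ.s≤s (ℕ.s≤s ())) _ _

      decimation-shift-trivial : p ≢ 5 → A ^ T ≈ A
      decimation-shift-trivial p≢5 with (A ^ D) ≈? 1#
      ... | yes γ≈1 = γ≈1⇒τ≈α γ≈1
      ... | no  γ≉1 = m≤2⇒τ≈A p≢5 (ℕ.≮⇒≥ (γ≉1⇒2≮m γ≉1)) n≡m+m α^m≈-1

    -- Multipliers and shift-equivalent decimations

    module _ (p≢5 : p ≢ 5) where

      -- With `u` inverse to `t`, the residues x = t i and y = i + u c satisfy x + c = t y. So t S =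
      -- S + c makes their bits agree, a shift of the sequence by u c.
      multiplier⇒1 : ∀ {t} → Exp.MultiplierGroup (slceSet α) t → Exp.1# ≡ t
      multiplier⇒1 {t} ((u , tu≡1) , c , to , from) = A^toℕ-injective (trans A^1
        (sym (decimation-shift-trivial (toℕ t) (toℕ u) (toℕ u ℕ.* toℕ c) τᵘ≈A shift p≢5)))
        where
        τᵘ≈A = A^unit {t} {u} tu≡1

        t*-injective : ∀ {x y} → t Exp.* x ≡ t Exp.* y → x ≡ y
        t*-injective {x} {y} tx≡ty = A^toℕ-injective (begin
          A ^ toℕ x                          ≈⟨ ^-congˡ (toℕ x) (sym τᵘ≈A) ⟩
          ((A ^ toℕ t) ^ toℕ u) ^ toℕ x      ≈⟨ ^-swap (A ^ toℕ t) (toℕ u) (toℕ x) ⟩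
          ((A ^ toℕ t) ^ toℕ x) ^ toℕ u      ≈⟨ ^-congˡ (toℕ u) (trans (sym (A^* t x))
                                                 (trans (reflexive (≡.cong (λ x → A ^ toℕ x) tx≡ty)) (A^* t y))) ⟩
          ((A ^ toℕ t) ^ toℕ y) ^ toℕ u      ≈⟨ ^-swap (A ^ toℕ t) (toℕ y) (toℕ u) ⟩
          ((A ^ toℕ t) ^ toℕ u) ^ toℕ y      ≈⟨ ^-congˡ (toℕ y) τᵘ≈A ⟩
          A ^ toℕ y                          ∎)

        +c-injective : ∀ {x y} → x Exp.+ c ≡ y Exp.+ c → x ≡ y
        +c-injective {x} {y} x+c≡y+c = A^toℕ-injective (*-cancelˡ-≉0 (A^≉0 (toℕ c)) (begin
          A ^ toℕ c * A ^ toℕ x    ≈⟨ *-comm _ _ ⟩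
          A ^ toℕ x * A ^ toℕ c    ≈⟨ sym (A^+ x c) ⟩
          A ^ toℕ (x Exp.+ c)      ≡⟨ ≡.cong (λ x → A ^ toℕ x) x+c≡y+c ⟩
          A ^ toℕ (y Exp.+ c)      ≈⟨ A^+ y c ⟩
          A ^ toℕ y * A ^ toℕ c    ≈⟨ *-comm _ _ ⟩
          A ^ toℕ c * A ^ toℕ y    ∎))

        -- Each inclusion of images only supplies some preimage in `S`; injectivity of the two maps
        -- identifies it with the given one.
        bits-agree : ∀ {x y} → x Exp.+ c ≡ t Exp.* y → slce α (toℕ x) ≡ slce α (toℕ y)
        bits-agree {x} {y} x+c≡ty = bit-extensional
          (λ x∈S → let y′ , y′∈S , eq = from (x , x∈S , ≡.refl) in
            ≡.subst (slceSet α) (≡.sym (t*-injective {y} {y′} (≡.trans (≡.sym x+c≡ty) eq))) y′∈S)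
          (λ y∈S → let x′ , x′∈S , eq = to (y , y∈S , x+c≡ty) in
            ≡.subst (slceSet α) (≡.sym (+c-injective {x} {x′} eq)) x′∈S)

        shift : ∀ i → slce α (toℕ t ℕ.* i) ≡ slce α (i ℕ.+ toℕ u ℕ.* toℕ c)
        shift i = ≡.trans (slce-cong (toℕ t ℕ.* i) (toℕ a) (sym (A^mod (toℕ t ℕ.* i))))
          (≡.trans (bits-agree {a} {b} (A^toℕ-injective (begin
            A ^ toℕ (a Exp.+ c)                              ≈⟨ A^+ a c ⟩
            A ^ toℕ a * A ^ toℕ c                            ≈⟨ *-cong (trans (A^mod (toℕ t ℕ.* i)) (sym (^-assocʳ A (toℕ t) i)))
                                                                  (trans (^-congˡ (toℕ c) (sym τᵘ≈A)) (^-assocʳ τ (toℕ u) (toℕ c))) ⟩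
            τ ^ i * τ ^ (toℕ u ℕ.* toℕ c)                    ≈⟨ sym (^-homo-* τ i (toℕ u ℕ.* toℕ c)) ⟩
            τ ^ (i ℕ.+ toℕ u ℕ.* toℕ c)                      ≈⟨ ^-swap A (toℕ t) (i ℕ.+ toℕ u ℕ.* toℕ c) ⟩
            (A ^ (i ℕ.+ toℕ u ℕ.* toℕ c)) ^ toℕ t            ≈⟨ ^-congˡ (toℕ t) (sym (A^mod (i ℕ.+ toℕ u ℕ.* toℕ c))) ⟩
            (A ^ toℕ b) ^ toℕ t                              ≈⟨ ^-swap A (toℕ b) (toℕ t) ⟩
            τ ^ toℕ b                                        ≈⟨ sym (A^* t b) ⟩
            A ^ toℕ (t Exp.* b)                              ∎)))
          (slce-cong (toℕ b) (i ℕ.+ toℕ u ℕ.* toℕ c) (A^mod (i ℕ.+ toℕ u ℕ.* toℕ c))))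
          where
          τ = A ^ toℕ t
          a b : Fin n
          a = (toℕ t ℕ.* i) mod n
          b = (i ℕ.+ toℕ u ℕ.* toℕ c) mod n

      multiplier-group-trivial : Exp.MultiplierGroup (slceSet α) ≐ ｛ Exp.1# ｝
      multiplier-group-trivial = multiplier⇒1 , λ { ≡.refl → 1-multiplier }

      -- Replacing i by v i, where `v` is inverse to `u`, turns the right side into the sequence
      -- itself: s_{t v i} = s_{i + ℓ u}. Hence t v is 1 modulo `n`, that is t = u. The inverse of t
      -- v that has to be supplied is r u.
      shiftEquivalent⇒≡ : ∀ t u → Exp.IsUnit t → Exp.IsUnit u →
        Exp.ShiftEquivalent (slce α [ Exp.leastPositive t ]) (slce α [ Exp.leastPositive u ]) → t ≡ u
      shiftEquivalent⇒≡ t u (r , tr≡1) (v , uv≡1) (ℓ , shifted) = A^toℕ-injective (begin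
        A ^ toℕ t                      ≈⟨ sym (A^leastPositive t) ⟩
        A ^ t′                         ≈⟨ ^-congˡ t′ (sym uᵛ≈A) ⟩
        ((A ^ u′) ^ toℕ v) ^ t′        ≈⟨ ^-congˡ t′ (^-swap A u′ (toℕ v)) ⟩
        ((A ^ toℕ v) ^ u′) ^ t′        ≈⟨ ^-swap (A ^ toℕ v) u′ t′ ⟩
        ((A ^ toℕ v) ^ t′) ^ u′        ≈⟨ ^-congˡ u′ (trans (^-swap A (toℕ v) t′) (^-assocʳ A t′ (toℕ v))) ⟩
        (A ^ (t′ ℕ.* toℕ v)) ^ u′      ≈⟨ ^-congˡ u′ (decimation-shift-trivial (t′ ℕ.* toℕ v) (toℕ r ℕ.* u′) (D ℕ.* u′) inverse shift p≢5) ⟩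
        A ^ u′                         ≈⟨ A^leastPositive u ⟩
        A ^ toℕ u                      ∎)
        where
        t′ u′ D : ℕ
        t′ = Exp.leastPositive t
        u′ = Exp.leastPositive u
        D = ℓ %ℕ n

        uᵛ≈A : (A ^ u′) ^ toℕ v ≈ A
        uᵛ≈A = trans (^-congˡ (toℕ v) (A^leastPositive u)) (A^unit {u} {v} uv≡1)

        inverse : (A ^ (t′ ℕ.* toℕ v)) ^ (toℕ r ℕ.* u′) ≈ A
        inverse = begin
          (A ^ (t′ ℕ.* toℕ v)) ^ (toℕ r ℕ.* u′)    ≈⟨ sym (^-assocʳ _ (toℕ r) u′) ⟩
          ((A ^ (t′ ℕ.* toℕ v)) ^ toℕ r) ^ u′      ≈⟨ ^-congˡ u′ (begin
            (A ^ (t′ ℕ.* toℕ v)) ^ toℕ r             ≈⟨ ^-congˡ (toℕ r) (sym (^-assocʳ A t′ (toℕ v))) ⟩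
            ((A ^ t′) ^ toℕ v) ^ toℕ r               ≈⟨ ^-swap (A ^ t′) (toℕ v) (toℕ r) ⟩
            ((A ^ t′) ^ toℕ r) ^ toℕ v               ≈⟨ ^-congˡ (toℕ v) (trans (^-congˡ (toℕ r) (A^leastPositive t)) (A^unit {t} {r} tr≡1)) ⟩
            A ^ toℕ v                                ∎) ⟩
          (A ^ toℕ v) ^ u′                         ≈⟨ ^-swap A (toℕ v) u′ ⟩
          (A ^ u′) ^ toℕ v                         ≈⟨ uᵛ≈A ⟩
          A                                        ∎

        shift : ∀ i → slce α (t′ ℕ.* toℕ v ℕ.* i) ≡ slce α (i ℕ.+ D ℕ.* u′)
        shift i = ≡.trans (≡.cong (slce α) (ℕ.*-assoc t′ (toℕ v) i))
          (≡.trans (shifted (toℕ v ℕ.* i)) (slce-cong (u′ ℕ.* ((+ (toℕ v ℕ.* i) ℤ.+ ℓ) %ℕ n)) (i ℕ.+ D ℕ.* u′) (begin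
            A ^ (u′ ℕ.* ((+ (toℕ v ℕ.* i) ℤ.+ ℓ) %ℕ n))
              ≡⟨ ≡.cong (λ e → A ^ (u′ ℕ.* e)) (ResidueMap.[+i+ℓ]%ℕ≡[i+ℓ%ℕ]% n (toℕ v ℕ.* i) ℓ) ⟩
            A ^ (u′ ℕ.* ((toℕ v ℕ.* i ℕ.+ D) % n))
              ≈⟨ trans (sym (^-assocʳ A u′ _)) (^-swap A u′ ((toℕ v ℕ.* i ℕ.+ D) % n)) ⟩
            (A ^ ((toℕ v ℕ.* i ℕ.+ D) % n)) ^ u′
              ≈⟨ ^-congˡ u′ (trans (α^% (toℕ v ℕ.* i ℕ.+ D)) (^-homo-* A (toℕ v ℕ.* i) D)) ⟩
            (A ^ (toℕ v ℕ.* i) * A ^ D) ^ u′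
              ≈⟨ ^-distrib-* _ _ u′ ⟩
            (A ^ (toℕ v ℕ.* i)) ^ u′ * (A ^ D) ^ u′
              ≈⟨ *-cong (begin
                   (A ^ (toℕ v ℕ.* i)) ^ u′       ≈⟨ ^-swap A (toℕ v ℕ.* i) u′ ⟩
                   (A ^ u′) ^ (toℕ v ℕ.* i)       ≈⟨ sym (^-assocʳ (A ^ u′) (toℕ v) i) ⟩
                   ((A ^ u′) ^ toℕ v) ^ i         ≈⟨ ^-congˡ i uᵛ≈A ⟩
                   A ^ i                          ∎) (^-assocʳ A D u′) ⟩
            A ^ i * A ^ (D ℕ.* u′)
              ≈⟨ sym (^-homo-* A i (D ℕ.* u′)) ⟩
            A ^ (i ℕ.+ D ℕ.* u′) ∎)))

      unitDecimation-injective : ∀ t u → Exp.IsUnit t → Exp.IsUnit u →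
        slce α [ Exp.leastPositive t ] ≗ slce α [ Exp.leastPositive u ] → t ≡ u
      unitDecimation-injective t u t-unit u-unit same = shiftEquivalent⇒≡ t u t-unit u-unit (ℤ.0ℤ , λ i →
        ≡.trans (same i) (slce-cong (u′ ℕ.* i) (u′ ℕ.* ((+ i ℤ.+ ℤ.0ℤ) %ℕ n)) (begin
          A ^ (u′ ℕ.* i)                            ≈⟨ trans (sym (^-assocʳ A u′ i)) (^-swap A u′ i) ⟩
          (A ^ i) ^ u′                              ≈⟨ ^-congˡ u′ (sym (α^% i)) ⟩
          (A ^ (i % n)) ^ u′                        ≈⟨ trans (^-swap A (i % n) u′) (^-assocʳ A u′ (i % n)) ⟩
          A ^ (u′ ℕ.* (i % n))                      ≡⟨ ≡.cong (λ j → A ^ (u′ ℕ.* (j % n))) (≡.sym (ℕ.+-identityʳ i)) ⟩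
          A ^ (u′ ℕ.* ((+ i ℤ.+ ℤ.0ℤ) %ℕ n))        ∎)))
        where u′ = Exp.leastPositive u

-- Counting the decimations by units

lookup-injective : ∀ {A : Set} {xs : List A} → Unique xs → ∀ {i j} → lookup xs i ≡ lookup xs j → i ≡ j
lookup-injective (_ ∷ _)      {zero}  {zero}  _  = ≡.refl
lookup-injective (x∉xs ∷ _)   {zero}  {suc j} eq = contradiction eq (All.lookup x∉xs (∈-lookup j))
lookup-injective (x∉xs ∷ _)   {suc i} {zero}  eq = contradiction (≡.sym eq) (All.lookup x∉xs (∈-lookup i))
lookup-injective (_ ∷ unique) {suc i} {suc j} eq = ≡.cong suc (lookup-injective unique eq)

module UnitEnumeration (n : ℕ) .{{_ : NonZero n}} (n≢1 : n ≢ 1) where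

  open Residues n
  open ResidueMap n
  open Congruence n
  open CommutativeRing ring using (refl; sym; trans)

  ι-leastPositive : ∀ t → + leastPositive t ≈ ι t
  ι-leastPositive zero    = ∣⇒≈0 ℕ∣.∣-refl
  ι-leastPositive (suc _) = refl

  leastPositive>0 : ∀ t → 0 < leastPositive t
  leastPositive>0 zero    = ℕ.>-nonZero⁻¹ n
  leastPositive>0 (suc _) = ℕ.s≤s ℕ.z≤n

  leastPositive≤n : ∀ t → leastPositive t ≤ n
  leastPositive≤n zero        = ℕ.≤-refl
  leastPositive≤n t@(suc _)   = ℕ.<⇒≤ (toℕ<n t)

  toℕ≢0⇒leastPositive≡toℕ : ∀ (t : Fin n) → toℕ t ≢ 0 → leastPositive t ≡ toℕ t
  toℕ≢0⇒leastPositive≡toℕ zero    t≢0 = contradiction ≡.refl t≢0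
  toℕ≢0⇒leastPositive≡toℕ (suc _) _ = ≡.refl

  -- A common divisor divides both t u and t u - 1, hence their difference 1.
  unit⇒coprime : ∀ {t} → IsUnit t → Coprime (leastPositive t) n
  unit⇒coprime {t} (u , tu≡1) {d} (d∣t , d∣n) = ℕ∣.∣1⇒≡1 (ℤ∣.∣⇒∣ᵤ {+ d} {1ℤ} (≡.subst (+ d ℤ∣.∣_)
    (solve 1 (λ x → x :- (x :- con 1ℤ) := con 1ℤ) ≡.refl (+ leastPositive t ℤ.* ι u))
    (ℤ∣.∣m∣n⇒∣m-n (ℤ∣.∣m⇒∣m*n {m = + leastPositive t} (ι u) (ℤ∣.∣ᵤ⇒∣ d∣t)) (ℤ∣.∣-trans (ℤ∣.∣ᵤ⇒∣ d∣n) (difference lp*u≈1)))))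
    where
    open ℤSolver
    lp*u≈1 : + leastPositive t ℤ.* ι u ≈ 1ℤ
    lp*u≈1 = trans (CommutativeRing.*-cong ring {+ leastPositive t} {ι t} {ι u} (ι-leastPositive t) refl)
      (trans (sym (ι-* t u)) (trans (≡⇒≈ (≡.cong ι tu≡1)) ι-1))

  inverse⇒unit : ∀ {k x} → + k ℤ.* + x ≈ 1ℤ → IsUnit (k mod n)
  inverse⇒unit {k} {x} kx≈1 = x mod n , ι-injective (trans (ι-* (k mod n) (x mod n))
    (trans (CommutativeRing.*-cong ring {ι (k mod n)} {+ k} {ι (x mod n)} {+ x} (ι-mod k) (ι-mod x))
    (trans kx≈1 (sym ι-1))))

  coprime⇒unit : ∀ k → Coprime k n → IsUnit (k mod n)
  coprime⇒unit k coprime with coprime-Bézout coprime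
  ... | Bézout.+- x y 1+yn≡xk = inverse⇒unit {k} {x} (congruent (ℤ∣.divides (+ y) (begin
    + k ℤ.* + x ℤ.- 1ℤ                 ≡⟨ ≡.cong (ℤ._- 1ℤ) (≡.trans (ℤ.*-comm (+ k) (+ x)) (≡.sym (ℤ.pos-* x k))) ⟩
    + (x ℕ.* k) ℤ.- 1ℤ                 ≡⟨ ≡.cong (λ e → + e ℤ.- 1ℤ) (≡.sym 1+yn≡xk) ⟩
    (1ℤ ℤ.+ + (y ℕ.* n)) ℤ.- 1ℤ        ≡⟨ solve 1 (λ e → (con 1ℤ :+ e) :- con 1ℤ := e) ≡.refl (+ (y ℕ.* n)) ⟩
    + (y ℕ.* n)                        ≡⟨ ℤ.pos-* y n ⟩
    + y ℤ.* + n                        ∎)))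
    where
    open ≡.≡-Reasoning
    open ℤSolver
  -- From 1 + x k ≡ 0 the inverse of k is x k x.
  ... | Bézout.-+ x y 1+xk≡yn = inverse⇒unit {k} {x ℕ.* k ℕ.* x} (congruent (ℤ∣.divides (+ y ℤ.* (+ (x ℕ.* k) ℤ.- 1ℤ)) (begin
    + k ℤ.* + (x ℕ.* k ℕ.* x) ℤ.- 1ℤ
      ≡⟨ ≡.cong (λ e → + k ℤ.* e ℤ.- 1ℤ) (ℤ.pos-* (x ℕ.* k) x) ⟩
    + k ℤ.* (+ (x ℕ.* k) ℤ.* + x) ℤ.- 1ℤ
      ≡⟨ solve 3 (λ k e x → k :* (e :* x) :- con 1ℤ := (x :* k) :* e :- con 1ℤ) ≡.refl (+ k) (+ (x ℕ.* k)) (+ x) ⟩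
    (+ x ℤ.* + k) ℤ.* + (x ℕ.* k) ℤ.- 1ℤ
      ≡⟨ ≡.cong (λ e → e ℤ.* + (x ℕ.* k) ℤ.- 1ℤ) (≡.sym (ℤ.pos-* x k)) ⟩
    + (x ℕ.* k) ℤ.* + (x ℕ.* k) ℤ.- 1ℤ
      ≡⟨ solve 1 (λ e → e :* e :- con 1ℤ := (con 1ℤ :+ e) :* (e :- con 1ℤ)) ≡.refl (+ (x ℕ.* k)) ⟩
    + (1 ℕ.+ x ℕ.* k) ℤ.* (+ (x ℕ.* k) ℤ.- 1ℤ)
      ≡⟨ ≡.cong (ℤ._* (+ (x ℕ.* k) ℤ.- 1ℤ)) (≡.trans (≡.cong +_ 1+xk≡yn) (ℤ.pos-* y n)) ⟩
    (+ y ℤ.* + n) ℤ.* (+ (x ℕ.* k) ℤ.- 1ℤ)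
      ≡⟨ solve 3 (λ y n e → (y :* n) :* e := (y :* e) :* n) ≡.refl (+ y) (+ n) (+ (x ℕ.* k) ℤ.- 1ℤ) ⟩
    (+ y ℤ.* (+ (x ℕ.* k) ℤ.- 1ℤ)) ℤ.* + n ∎)))
    where
    open ≡.≡-Reasoning
    open ℤSolver

  totatives : List ℕ
  totatives = filter (λ k → coprime? k n) (map suc (upTo n))

  totatives-unique : Unique totatives
  totatives-unique = Unique.filter⁺ (λ k → coprime? k n) (Unique.map⁺ ℕ.suc-injective (Unique.upTo⁺ n))

  ∈-totatives⁺ : ∀ {k} → 0 < k → k ≤ n → Coprime k n → k ∈ totatives
  ∈-totatives⁺ {suc k} _ k<n = ∈-filter⁺ (λ k → coprime? k n) (∈-map⁺ suc (∈-upTo⁺ k<n))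

  ∈-totatives⁻ : ∀ {k} → k ∈ totatives → 0 < k × k < n × Coprime k n
  ∈-totatives⁻ {k} k∈ with ∈-filter⁻ (λ k → coprime? k n) {xs = map suc (upTo n)} k∈
  ... | k∈range , coprime with ∈-map⁻ suc k∈range
  ... | j , j∈ , ≡.refl = ℕ.s≤s ℕ.z≤n ,
    -- The range of `φ` includes `n`, which is coprime to itself only when it is 1.
    ℕ.≤∧≢⇒< (∈-upTo⁻ j∈) (λ { ≡.refl → n≢1 (coprime (ℕ∣.∣-refl , ℕ∣.∣-refl)) }) , coprime

  leastPositive-mod : ∀ k → 0 < k → k < n → leastPositive (k mod n) ≡ k
  leastPositive-mod k 0<k k<n = ≡.trans (toℕ≢0⇒leastPositive≡toℕ (k mod n) (λ k≡0 → ℕ.<⇒≢ 0<k (≡.sym (≡.trans (≡.sym toℕ≡k) k≡0)))) toℕ≡k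
    where
    toℕ≡k : toℕ (k mod n) ≡ k
    toℕ≡k = ≡.trans (toℕ-mod k n) (m<n⇒m%n≡m k<n)

  -- `φ n` is by definition the length of `totatives`, and `leastPositive` takes its values in the
  -- same range 1 , ... , n. So the totatives are exactly the decimation indices of the units, and
  -- positions in the list enumerate the family.
  unitDecimations-bijection : (s : Sequence) →
    (∀ t u → IsUnit t → IsUnit u → s [ leastPositive t ] ≗ s [ leastPositive u ] → t ≡ u) →
    Bijection (setoid (Fin (φ n))) (memberSetoid (UnitDecimations s))
  unitDecimations-bijection s injective = record
    { to        = λ i → s [ k i ] , k i mod n , unit i , λ j → ≡.cong (λ k → s (k ℕ.* j)) (≡.sym (leastPositive-k i))
    ; cong      = λ { ≡.refl _ → ≡.refl }
    ; bijective =
      (λ {i} {j} same → lookup-injective totatives-unique (begin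
        k i                        ≡⟨ leastPositive-k i ⟨
        leastPositive (k i mod n)  ≡⟨ ≡.cong leastPositive (injective (k i mod n) (k j mod n) (unit i) (unit j) (λ e →
                                       ≡.trans (≡.cong (λ k → s (k ℕ.* e)) (leastPositive-k i))
                                       (≡.trans (same e) (≡.cong (λ k → s (k ℕ.* e)) (≡.sym (leastPositive-k j)))))) ⟩
        leastPositive (k j mod n)  ≡⟨ leastPositive-k j ⟩
        k j                        ∎)) ,
      λ { (a , t , t-unit , a≗) →
        let t∈ = ∈-totatives⁺ (leastPositive>0 t) (leastPositive≤n t) (unit⇒coprime {t} t-unit) in
        index t∈ , λ { ≡.refl e → ≡.trans (≡.cong (λ k → s (k ℕ.* e)) (≡.sym (lookup-index t∈))) (≡.sym (a≗ e)) } }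
    }
    where
    open ≡.≡-Reasoning
    k : Fin (φ n) → ℕ
    k = lookup totatives
    unit : ∀ i → IsUnit (k i mod n)
    unit i = coprime⇒unit (k i) (proj₂ (proj₂ (∈-totatives⁻ (∈-lookup {xs = totatives} i))))
    leastPositive-k : ∀ i → leastPositive (k i mod n) ≡ k i
    leastPositive-k i with ∈-totatives⁻ (∈-lookup {xs = totatives} i)
    ... | 0<k , k<n , _ = leastPositive-mod (k i) 0<k k<n

-- Specialisation to the integers modulo an odd prime

2∤1+n⇒n≡m+m : ∀ n → 2 ∤ suc n → ∃[ m ] n ≡ m ℕ.+ m
2∤1+n⇒n≡m+m n 2∤1+n with even⊎odd n
... | m , inj₁ n≡2m   = m , n≡2m
... | m , inj₂ n≡2m+1 = contradiction (ℕ∣.divides (suc m) (≡.trans (≡.cong suc n≡2m+1)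
  (≡.cong (λ i → 2 ℕ.+ i) (≡.trans (≡.cong (λ i → m ℕ.+ i) (≡.sym (ℕ.+-identityʳ m))) (ℕ.*-comm 2 m))))) 2∤1+n

module Characteristic (p : ℕ) where
  open Congruence p
  open Mult (CommutativeRing.semiring ring) using () renaming (_×_ to _·_)

  ·1≡+ : ∀ j → j · 1ℤ ≡ + j
  ·1≡+ zero    = ≡.refl
  ·1≡+ (suc j) = ≡.cong (λ i → 1ℤ ℤ.+ i) (·1≡+ j)

  characteristic : ∀ {j} → j · 1ℤ ≈ 0ℤ → p ℕ∣.∣ j
  characteristic {j} j≈0 = ≈0⇒∣ (≡.subst (_≈ 0ℤ) (·1≡+ j) j≈0)

  p≈0 : p · 1ℤ ≈ 0ℤ
  p≈0 = ≡.subst (_≈ 0ℤ) (≡.sym (·1≡+ p)) (∣⇒≈0 ℕ∣.∣-refl)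

theorem4p3 : (p : ℕ) .{{_ : NonTrivial p}} → Prime p → 2 ∤ p → p ≢ 5 →
    let open SLCE p in
    (α : Fin p) → IsPrimitive α →
    (Exp.MultiplierGroup (slceSet α) ≐ ｛ Exp.1# ｝)
    × Bijection (setoid (Fin (φ (p ∸ 1)))) (memberSetoid (Exp.UnitDecimations (slce α)))
    × (∀ t u → Exp.IsUnit t → Exp.IsUnit u → t ≢ u →
    ¬ Exp.ShiftEquivalent (slce α [ Exp.leastPositive t ]) (slce α [ Exp.leastPositive u ]))
theorem4p3 0 p-prime = contradiction p-prime ¬prime[0]
theorem4p3 1 p-prime = contradiction p-prime ¬prime[1]
theorem4p3 p@(suc n@(suc k)) p-prime 2∤p p≢5 α α-primitive =
  S.multiplier-group-trivial m n≡m+m p≢5 ,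
  U.unitDecimations-bijection (SLCE.slce p α) (S.unitDecimation-injective m n≡m+m p≢5) ,
  λ t u t-unit u-unit t≢u t∼u → t≢u (S.shiftEquivalent⇒≡ m n≡m+m p≢5 t u t-unit u-unit t∼u)
  where
  m = proj₁ (2∤1+n⇒n≡m+m n 2∤p)
  n≡m+m = proj₂ (2∤1+n⇒n≡m+m n 2∤p)
  open Congruence p
  open ResidueMap p
  open Characteristic p
  1≉0 : ¬ 1ℤ ≈ 0ℤ
  1≉0 1≈0 = ¬prime[1] (≡.subst Prime (ℕ∣.∣1⇒≡1 (≈0⇒∣ 1≈0)) p-prime)
  domain : IntegralDomain ring
  domain = record { integral = integral p-prime ; 1≉0 = 1≉0 ; _≈?_ = _≈?_ }
  model : ResidueModel ring p
  model = record
    { characteristic = characteristic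
    ; p≈0            = p≈0
    ; ι              = ι
    ; ι-injective    = ι-injective
    ; ι-surjective   = ι-surjective
    ; ι-+            = ι-+
    ; ι-*            = ι-*
    ; ι-0            = ι-0
    ; ι-1            = ι-1
    }
  module S = SLCESequence ring domain k p-prime model α α-primitive
  n≢1 : n ≢ 1
  n≢1 n≡1 = ℕ.even≢odd m 0 (≡.trans (≡.cong (λ i → m ℕ.+ i) (ℕ.+-identityʳ m)) (≡.trans (≡.sym n≡m+m) n≡1))
  module U = UnitEnumeration n n≢1
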